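{- Let $B(u)$ be the generating matrix of the reflection algebra $\mathcal B(n,l)$. For each $\eta=(\eta_1,\dots,\eta_n)\in I_n$ define permutations $p_\eta^{[i]}\in S_n$, $i=1,\dots,n$, recursively by $$p_\eta^{[n]}:=\mathrm{Id},\qquad p_\eta^{[i]}:=p_\eta^{[i+1]}\,\bigl(i,\,(p_\eta^{[i+1]})^{ -1}(\eta_i)\bigr)\quad\text{for } i=n-1,n-2,\dots,1,$$ and put $p_\eta:=p_\eta^{[1]}$. Then $$\langle\langle B_1,\dots,B_n\rangle\rangle=\sum_{\eta\in I_n}\alpha(\eta)\,p_\eta^{ -1}\,B_{\eta_1}(u)\,B_{\eta_2}(u-1)\cdots B_{\eta_n}(u-n+1),$$ where $p_\eta^{ -1}\in S_n$ is identified with the corresponding operator acting on $(\mathbb C^n)^{\otimes n}$.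
   Context: Reflection algebra. Let $n=m+l$ with $m,l$ nonnegative integers, and $\varepsilon_i=1$ for $1\le i\le m$, $\varepsilon_i=-1$ for $m<i\le n$. Let $P:v\otimes w\mapsto w\otimes v$ on $\mathbb C^n\otimes\mathbb C^n$ and $R(u)=1-P/u$. The reflection algebra $\mathcal B(n,l)$ is the unital associative algebra over $\mathbb C$ with generators $b_{ij}^{(r)}$ ($i,j=1,\dots,n$, $r=0,1,2,\dots$), $b_{ij}^{(0)}=\delta_{ij}\varepsilon_i$, collected into series $b_i^j(u)=\sum_{r\ge0}b_{ij}^{(r)}u^{ -r}$ and the matrix $B(u)=\sum_{i,j}E_{ij}\otimes b_i^j(u)\in\operatorname{End}\mathbb C^n\otimes\mathcal B(n,l)[[u^{ -1}]]$, subject to the reflection equation $R(u-v)B_1(u)R(u+v)B_2(v)=B_2(v)R(u+v)B_1(u)R(u-v)$ and the unitary condition $B(u)B(-u)=1$. For a matrix $X=(x_{ij})$ over an associative algebra $A$, $X_s=\sum_{i,j}1\otimes\cdots\otimes E_{ij}\otimes\cdots\otimes1\otimes x_{ij}\in\operatorname{End}(\mathbb C^n)^{\otimes n}\otimes A$ with $E_{ij}$ in the $s$-th position; $P_{ij}$ denotes $P$ acting on the $i$-th and $j$-th copies of $\mathbb C^n$ in $(\mathbb C^n)^{\otimes n}$. The symmetric group $S_n$ acts on $(\mathbb C^n)^{\otimes n}$ by permuting tensor factors, the transposition $(i,j)$ acting as $P_{ij}$ (a product of transpositions acts as the product of the corresponding operators in the same order); $(k,k)$ denotes the identity permutation. Products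 of permutations are composed from right to left. Shifted series and rational functions of $u$ are expanded as power series in $u^{ -1}$. For $k=1,\dots,n$ put $\Pi_k=1-(2u-k-n+2)^{ -1}\sum_{i=k+1}^nP_{ki}$, and $$\langle\langle B_1,\dots,B_n\rangle\rangle=B_1(u)\Pi_1B_2(u-1)\Pi_2\cdots B_{n-1}(u-n+2)\Pi_{n-1}B_n(u-n+1).$$ $I_n\subset\mathbb Z^n$ is the set of $n$-tuples $\eta=(\eta_1,\dots,\eta_n)$ with $i\le\eta_i\le n$ for all $i=1,\dots,n$, and $\alpha(\eta)=\prod_{i:\,i<\eta_i}\frac{1}{n-2u-2+i}$. -}

module Defs where

open import Algebra.Apartness.Bundles using (HeytingField; HeytingCommutativeRing)
open import Algebra.Bundles using (CommutativeRing; Ring)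
open import Algebra.Bundles.Raw using (RawRing)
import Algebra.Definitions.RawSemiring as RawSemiringDefinitions
open import Data.Bool.Base using (if_then_else_)
open import Data.Fin.Base using (Fin; zero; suc; toℕ; inject₁; splitAt)
open import Data.Fin.Permutation using (Permutation′; id; transpose; _∘ₚ_; _⟨$⟩ˡ_)
open import Data.Fin.Properties using (_≟_; _≤?_; _<?_; all?)
open import Data.Integer.Base as ℤ using (ℤ; +_; -[1+_])
open import Data.List.Base using (List; []; _∷_; foldr; filter; upTo; allFin; cartesianProductWith)
open import Data.Nat.Base as ℕ using (ℕ; zero; suc; _∸_)
open import Data.Product.Base using (_,_; proj₁)
open import Data.Sum.Base using ([_,_]′)
open import Data.Vec.Base using (Vec; []; _∷_; lookup; tabulate; _[_]≔_)
import Data.Vec.Properties as Vec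
open import Level using (Level; _⊔_)
open import Relation.Binary.Definitions using (DecidableEquality)
open import Relation.Binary.PropositionalEquality.Core using (_≡_)
open import Relation.Nullary.Decidable.Core using (does)

private
  variable
    a c ℓ ℓ₁ ℓ₂ r x : Level

module _ (R : RawRing c ℓ) where
  open RawRing R

  ∑ : {X : Set x} → List X → (X → Carrier) → Carrier
  ∑ xs f = foldr (λ y s → f y + s) 0# xs

  -- The factors are multiplied from left to right in the order of the list.
  ∏ : {X : Set x} → List X → (X → Carrier) → Carrier
  ∏ xs f = foldr (λ y s → f y * s) 1# xs

  constant : Carrier → ℕ → Carrier
  constant y zero    = y
  constant y (suc _) = 0#

  -- R[[u⁻¹]]: the series f stands for Σ_{r ≥ 0} f(r) u⁻ʳ.
  powerSeriesRing : RawRing c ℓ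
  powerSeriesRing = record
    { Carrier = ℕ → Carrier
    ; _≈_     = λ f g → ∀ s → f s ≈ g s
    ; _+_     = λ f g s → f s + g s
    ; _*_     = λ f g s → ∑ (upTo (suc s)) (λ i → f i * g (s ∸ i))
    ; -_      = λ f s → - f s
    ; 0#      = λ _ → 0#
    ; 1#      = constant 1#
    }

  -- (u - y)⁻¹ = Σ_{k ≥ 0} yᵏ u⁻ᵏ⁻¹
  [u-_]⁻¹ : Carrier → ℕ → Carrier
  [u- y ]⁻¹ zero    = 0#
  [u- y ]⁻¹ (suc k) = y ^ k
    where open RawSemiringDefinitions rawSemiring using (_^_)

  -- f(u) ↦ f(u - k) = Σ_r f(r) (u - k)⁻ʳ. As (u - k)⁻ʳ is a multiple of u⁻ʳ,
  -- only r ≤ s contribute to the coefficient of u⁻ˢ.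
  shift : ℕ → (ℕ → Carrier) → ℕ → Carrier
  shift k f s = ∑ (upTo (suc s)) (λ i → f i * ([u- k × 1# ]⁻¹ ^ i) s)
    where
    open RawSemiringDefinitions rawSemiring using (_×_)
    open RawSemiringDefinitions (RawRing.rawSemiring powerSeriesRing) using (_^_)

  -- f(u) ↦ f(-u)
  negateVariable : (ℕ → Carrier) → ℕ → Carrier
  negateVariable f s = (- 1#) ^ s * f s
    where open RawSemiringDefinitions rawSemiring using (_^_)

  -- laurent N f stands for vᴺ Σ_{i ≥ 0} f(i) v⁻ⁱ.
  record Laurent : Set c where
    constructor laurent
    field
      order  : ℕ
      coeffs : ℕ → Carrier

  -- The coefficient of v⁻ᶻ.
  coefficient : Laurent → ℤ → Carrier
  coefficient (laurent N f) z with z ℤ.+ (+ N)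
  ... | + i      = f i
  ... | -[1+ _ ] = 0#

  -- The Laurent series in v⁻¹: finitely many positive powers of v.
  laurentRing : RawRing c ℓ
  laurentRing = record
    { Carrier = Laurent
    ; _≈_     = λ f g → ∀ z → coefficient f z ≈ coefficient g z
    ; _+_     = λ f g → let N = Laurent.order f ℕ.⊔ Laurent.order g in
                  laurent N (λ i → coefficient f (i ℤ.⊖ N) + coefficient g (i ℤ.⊖ N))
    ; _*_     = λ f g → laurent (Laurent.order f ℕ.+ Laurent.order g)
                  (RawRing._*_ powerSeriesRing (Laurent.coeffs f) (Laurent.coeffs g))
    ; -_      = λ f → laurent (Laurent.order f) (λ i → - Laurent.coeffs f i)
    ; 0#      = laurent 0 (λ _ → 0#)
    ; 1#      = laurent 0 (constant 1#)
    }

  indeterminate : Laurent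
  indeterminate = laurent 1 (constant 1#)

  Matrix : Set a → Set (a ⊔ c)
  Matrix I = I → I → Carrier

  -- Matrices whose rows and columns are indexed by the elements of a
  -- repetition-free complete list.
  matrixRing : {I : Set a} → DecidableEquality I → List I → RawRing (a ⊔ c) (a ⊔ ℓ)
  matrixRing {I = I} _≟ᴵ_ indices = record
    { Carrier = Matrix I
    ; _≈_     = λ M N → ∀ i j → M i j ≈ N i j
    ; _+_     = λ M N i j → M i j + N i j
    ; _*_     = λ M N i j → ∑ indices (λ k → M i k * N k j)
    ; -_      = λ M i j → - M i j
    ; 0#      = λ _ _ → 0#
    ; 1#      = λ i j → if does (i ≟ᴵ j) then 1# else 0#
    }

tuples : ∀ n k → List (Vec (Fin n) k)
tuples n zero    = [] ∷ []
tuples n (suc k) = cartesianProductWith _∷_ (allFin n) (tuples n k)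

_≟ᵛ_ : ∀ {n k} → DecidableEquality (Vec (Fin n) k)
_≟ᵛ_ = Vec.≡-dec _≟_

-- End(Kⁿ)^{⊗k} ⊗ R as matrices over R, for K the ground ring: the tuple
-- J = (J₁, …, J_k) indexes the basis vector e_{J₁} ⊗ ⋯ ⊗ e_{J_k}, and the entry
-- of M at (I, J) is the coefficient of e_I in M e_J.
tensorEnd : RawRing c ℓ → (n k : ℕ) → RawRing c ℓ
tensorEnd R n k = matrixRing R _≟ᵛ_ (tuples n k)

module _ (R : RawRing c ℓ) {n k : ℕ} where
  open RawRing R

  -- X_s. The (I, J) entry of Σ_{ij} 1 ⊗ ⋯ ⊗ E_{ij} ⊗ ⋯ ⊗ 1 ⊗ x_{ij} is x_{I_s J_s}
  -- if I and J agree in all positions other than s, and 0 otherwise.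
  _at_ : Matrix R (Fin n) → Fin k → RawRing.Carrier (tensorEnd R n k)
  (X at s) I J = if does ((I [ s ]≔ lookup J s) ≟ᵛ J) then X (lookup I s) (lookup J s) else 0#

  -- σ moves the t-th tensor factor to position σ(t), so that position t of the
  -- image is occupied by the factor which was in position σ⁻¹(t).
  permutationOperator : Permutation′ k → RawRing.Carrier (tensorEnd R n k)
  permutationOperator σ I J =
    if does (I ≟ᵛ tabulate (λ t → lookup J (σ ⟨$⟩ˡ t))) then 1# else 0#

  P : Fin k → Fin k → RawRing.Carrier (tensorEnd R n k)
  P i j = permutationOperator (transpose i j)

module Presentation (K : CommutativeRing c ℓ) (X : Set x) where
  private module K = CommutativeRing K

  infix  8 ⊖_
  infixl 7 _⊗_
  infixl 6 _⊕_

  data Term : Set (c ⊔ x) where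
    gen    : X → Term
    scalar : K.Carrier → Term
    _⊕_    : Term → Term → Term
    _⊗_    : Term → Term → Term
    ⊖_     : Term → Term

  termRing : RawRing (c ⊔ x) (c ⊔ x)
  termRing = record
    { Carrier = Term
    ; _≈_     = _≡_
    ; _+_     = _⊕_
    ; _*_     = _⊗_
    ; -_      = ⊖_
    ; 0#      = scalar K.0#
    ; 1#      = scalar K.1#
    }

  module _ (_∼_ : Term → Term → Set r) where

    infix 4 _≋_

    -- The least K-algebra congruence containing the relations _∼_.
    data _≋_ : Term → Term → Set (c ⊔ ℓ ⊔ x ⊔ r) where
      relation     : ∀ {s t} → s ∼ t → s ≋ t
      ≋-refl       : ∀ {s} → s ≋ s
      ≋-sym        : ∀ {s t} → s ≋ t → t ≋ s
      ≋-trans      : ∀ {s t w} → s ≋ t → t ≋ w → s ≋ w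
      ⊕-cong       : ∀ {s s′ t t′} → s ≋ s′ → t ≋ t′ → s ⊕ t ≋ s′ ⊕ t′
      ⊗-cong       : ∀ {s s′ t t′} → s ≋ s′ → t ≋ t′ → s ⊗ t ≋ s′ ⊗ t′
      ⊖-cong       : ∀ {s s′} → s ≋ s′ → ⊖ s ≋ ⊖ s′
      ⊕-assoc      : ∀ s t w → (s ⊕ t) ⊕ w ≋ s ⊕ (t ⊕ w)
      ⊕-comm       : ∀ s t → s ⊕ t ≋ t ⊕ s
      ⊕-identityˡ  : ∀ s → scalar K.0# ⊕ s ≋ s
      ⊖-inverseˡ   : ∀ s → ⊖ s ⊕ s ≋ scalar K.0#
      ⊗-assoc      : ∀ s t w → (s ⊗ t) ⊗ w ≋ s ⊗ (t ⊗ w)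
      ⊗-identityˡ  : ∀ s → scalar K.1# ⊗ s ≋ s
      ⊗-distribˡ   : ∀ s t w → s ⊗ (t ⊕ w) ≋ s ⊗ t ⊕ s ⊗ w
      ⊗-distribʳ   : ∀ s t w → (t ⊕ w) ⊗ s ≋ t ⊗ s ⊕ w ⊗ s
      scalar-cong  : ∀ {y z} → y K.≈ z → scalar y ≋ scalar z
      scalar-+     : ∀ y z → scalar (y K.+ z) ≋ scalar y ⊕ scalar z
      scalar-*     : ∀ y z → scalar (y K.* z) ≋ scalar y ⊗ scalar z
      scalar-comm  : ∀ y s → scalar y ⊗ s ≋ s ⊗ scalar y

    presentedRing : Ring (c ⊔ x) (c ⊔ ℓ ⊔ x ⊔ r)
    presentedRing = record
      { Carrier = Term
      ; _≈_     = _≋_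
      ; _+_     = _⊕_
      ; _*_     = _⊗_
      ; -_      = ⊖_
      ; 0#      = scalar K.0#
      ; 1#      = scalar K.1#
      ; isRing  = record
        { +-isAbelianGroup = record
          { isGroup = record
            { isMonoid = record
              { isSemigroup = record
                { isMagma = record
                  { isEquivalence = record { refl = ≋-refl ; sym = ≋-sym ; trans = ≋-trans }
                  ; ∙-cong        = ⊕-cong
                  }
                ; assoc = ⊕-assoc
                }
              ; identity = ⊕-identityˡ
                         , λ s → ≋-trans (⊕-comm s _) (⊕-identityˡ s)
              }
            ; inverse = ⊖-inverseˡ
                      , λ s → ≋-trans (⊕-comm s _) (⊖-inverseˡ s)
            ; ⁻¹-cong = ⊖-cong
            }
          ; comm = ⊕-comm
          }
        ; *-cong     = ⊗-cong
        ; *-assoc    = ⊗-assoc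
        ; *-identity = ⊗-identityˡ
                     , λ s → ≋-trans (≋-sym (scalar-comm _ s)) (⊗-identityˡ s)
        ; distrib    = ⊗-distribˡ , ⊗-distribʳ
        }
      }

-- 𝓑(m + l, l), with K as the ground ring.
module ReflectionAlgebra (K : CommutativeRing c ℓ) (m l : ℕ) where
  private
    module K = CommutativeRing K

    n : ℕ
    n = m ℕ.+ l

  data Generator : Set where
    b : (i j : Fin n) (s : ℕ) → Generator

  open Presentation K Generator public

  ε : Fin n → K.Carrier
  ε i = [ (λ _ → K.1#) , (λ _ → K.- K.1#) ]′ (splitAt m i)

  generatingMatrix : Matrix (powerSeriesRing termRing) (Fin n)
  generatingMatrix i j s = gen (b i j s)

  module ReflectionEquation where
    -- Rational functions of u and v are expanded in u⁻¹, the coefficients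
    -- being Laurent series in v⁻¹.
    V U E : RawRing c c
    V = laurentRing termRing
    U = powerSeriesRing V
    E = tensorEnd U n 2

    open RawRing E using (Carrier; _+_; _*_; -_; 1#)

    v : Laurent termRing
    v = indeterminate termRing

    -- The argument of R is the expansion of the inverse of the spectral
    -- parameter: R w = 1 - w P.
    R : RawRing.Carrier U → Carrier
    R w = 1# + - (λ I J → RawRing._*_ U w (P U zero (suc zero) I J))

    R[u-v] R[u+v] B₁[u] B₂[v] : Carrier
    R[u-v] = R ([u-_]⁻¹ V v)
    R[u+v] = R ([u-_]⁻¹ V (RawRing.-_ V v))
    B₁[u]  = _at_ U (λ i j s → laurent 0 (constant termRing (gen (b i j s)))) zero
    B₂[v]  = _at_ U (λ i j → constant V (laurent 0 (λ s → gen (b i j s)))) (suc zero)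

    lhs rhs : Carrier
    lhs = R[u-v] * B₁[u] * R[u+v] * B₂[v]
    rhs = B₂[v] * R[u+v] * B₁[u] * R[u-v]

  module UnitaryCondition where
    open RawRing (matrixRing (powerSeriesRing termRing) _≟_ (allFin n)) using (Carrier; _*_; 1#)

    lhs rhs : Carrier
    lhs = generatingMatrix * (λ i j → negateVariable termRing (generatingMatrix i j))
    rhs = 1#

  -- Each equation of series holds coefficientwise: s is the exponent of u⁻¹
  -- and z that of v⁻¹.
  data _∼_ : Term → Term → Set c where
    initial    : ∀ i j → gen (b i j 0) ∼ scalar (if does (i ≟ j) then ε i else K.0#)
    reflection : ∀ I J s z →
      coefficient termRing (ReflectionEquation.lhs I J s) z ∼
      coefficient termRing (ReflectionEquation.rhs I J s) z
    unitary    : ∀ i j s → UnitaryCondition.lhs i j s ∼ UnitaryCondition.rhs i j s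

  reflectionAlgebra : Ring c (c ⊔ ℓ)
  reflectionAlgebra = presentedRing _∼_

CharacteristicZero : HeytingField c ℓ₁ ℓ₂ → Set ℓ₂
CharacteristicZero K = ∀ k → suc k × 1# # 0#
  where
  open HeytingField K
  open CommutativeRing (HeytingCommutativeRing.commutativeRing heytingCommutativeRing)
    using (rawRing)
  open RawSemiringDefinitions (RawRing.rawSemiring rawRing) using (_×_)

module Expansion (K : HeytingField c ℓ₁ ℓ₂) (char0 : CharacteristicZero K) where

  commutativeRing : CommutativeRing c ℓ₁
  commutativeRing =
    HeytingCommutativeRing.commutativeRing (HeytingField.heytingCommutativeRing K)

  open HeytingField K using (Carrier; _*_; -_; 1#; #⇒invertible)
  open CommutativeRing commutativeRing using (rawRing)
  open RawSemiringDefinitions (RawRing.rawSemiring rawRing) using (_×_)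

  fromℤ : ℤ → Carrier
  fromℤ (+ k)    = k × 1#
  fromℤ -[1+ k ] = - (suc k × 1#)

  1/ : (y : ℤ) → .{{ℤ.NonZero y}} → Carrier
  1/ (+ suc k) = proj₁ (#⇒invertible (char0 k))
  1/ -[1+ k ]  = - proj₁ (#⇒invertible (char0 k))

  -- 1 / (y u + z) = y⁻¹ (u - (- z y⁻¹))⁻¹ as a power series in u⁻¹
  1/[_u+_] : (y : ℤ) → .{{ℤ.NonZero y}} → ℤ → ℕ → Carrier
  1/[ y u+ z ] s = 1/ y * [u-_]⁻¹ rawRing (- (fromℤ z * 1/ y)) s

-- Recursion down from the greatest element of Fin (suc k).
descend : {A : Set a} (k : ℕ) → A → (Fin k → A → A) → Fin (suc k) → A
descend zero    y f zero    = y
descend (suc k) y f zero    = f zero (descend k y (λ i → f (suc i)) zero)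
descend (suc k) y f (suc i) = descend k y (λ j → f (suc j)) i

infixl 7 _·_

-- Composition from right to left, whereas _∘ₚ_ composes from left to right.
_·_ : ∀ {n} → Permutation′ n → Permutation′ n → Permutation′ n
σ · τ = τ ∘ₚ σ

I : ∀ n → List (Vec (Fin n) n)
I n = filter (λ η → all? (λ i → i ≤? lookup η i)) (tuples n n)

p[_] : ∀ {k} → Fin (suc k) → Vec (Fin (suc k)) (suc k) → Permutation′ (suc k)
p[ i ] η = descend _ id (λ j q → q · transpose (inject₁ j) (q ⟨$⟩ˡ lookup η (inject₁ j))) i

p : ∀ {n} → Vec (Fin n) n → Permutation′ n
p {zero}  η = id
p {suc k} η = p[ zero ] η

module Bracket (K : HeytingField c ℓ₁ ℓ₂) (char0 : CharacteristicZero K) (m l : ℕ) where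

  open Expansion K char0 public
  open ReflectionAlgebra commutativeRing m l public

  n : ℕ
  n = m ℕ.+ l

  𝓑 𝓑[[u⁻¹]] End : RawRing c (c ⊔ ℓ₁)
  𝓑        = Ring.rawRing reflectionAlgebra
  𝓑[[u⁻¹]] = powerSeriesRing 𝓑
  End      = tensorEnd 𝓑[[u⁻¹]] n n

  open RawRing End public using (Carrier; _≈_; _+_; _*_; -_; 1#)

  K[[u⁻¹]] : RawRing c ℓ₁
  K[[u⁻¹]] = powerSeriesRing (CommutativeRing.rawRing commutativeRing)

  infixr 8 _•_

  _•_ : RawRing.Carrier K[[u⁻¹]] → Carrier → Carrier
  (f • M) I J = RawRing._*_ 𝓑[[u⁻¹]] (λ s → scalar (f s)) (M I J)

  -- The 1-based number of an index: an element i of Fin n stands for toℕ i + 1.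
  number : Fin n → ℤ
  number i = + suc (toℕ i)

  -- B t k = B_t(u - k + 1), where k is numbered from 1.
  B : (t k : Fin n) → Carrier
  B t k = _at_ 𝓑[[u⁻¹]] (λ i j → shift 𝓑 (toℕ k) (generatingMatrix i j)) t

  Π : Fin n → Carrier
  Π k = 1# + - (1/[ + 2 u+ ℤ.- number k ℤ.- + n ℤ.+ + 2 ] •
                ∑ End (filter (k <?_) (allFin n)) (λ i → P 𝓑[[u⁻¹]] k i))

  -- Given the indices of all factors in order, forms B₁(u) Π₁ B₂(u-1) Π₂ ⋯ Bₙ(u-n+1),
  -- with Π only between consecutive factors B.
  interlace : List (Fin n) → Carrier
  interlace []           = 1#
  interlace (k ∷ [])     = B k k
  interlace (k ∷ i ∷ ks) = B k k * Π k * interlace (i ∷ ks)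

  ⟪B₁,…,Bₙ⟫ : Carrier
  ⟪B₁,…,Bₙ⟫ = interlace (allFin n)

  α : Vec (Fin n) n → RawRing.Carrier K[[u⁻¹]]
  α η = ∏ K[[u⁻¹]] (filter (λ i → i <? lookup η i) (allFin n))
          (λ i → 1/[ -[1+ 1 ] u+ + n ℤ.- + 2 ℤ.+ number i ])

  operator : Permutation′ n → Carrier
  operator = permutationOperator 𝓑[[u⁻¹]]

{-# OPTIONS --safe #-}

-- Since -1/(2u-k-n+2) = 1/(n-2u-2+k), each Π_k is a sum over i ≥ k of (k i), with coefficient 1 for i = k
-- and 1/(n-2u-2+k) otherwise. Expand the bracket from the right. If q = p^[k+1] belongs to a term of the
-- expansion of the factors k+1, …, n, then multiplying by B_k and (k i) gives B_k (k i) q⁻¹, which is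
-- σ⁻¹ B_{q(i)} for σ = q (k i), because σ⁻¹ moves the factor q(i) to position k. As q fixes 1, …, k, the
-- substitution η_k = q(i) permutes {k, …, n} and fixes k, so the coefficients agree, and σ = p^[k].

module Submission where

open import Defs
open import Algebra.Apartness.Bundles using (HeytingField)
open import Algebra.Bundles using (CommutativeRing; Ring)
open import Algebra.Bundles.Raw using (RawRing)
import Algebra.Construct.Pointwise as Pointwise
import Algebra.Properties.CommutativeMonoid.Sum as CommutativeMonoidSum
import Algebra.Properties.CommutativeSemigroup as CommutativeSemigroupProperties
import Algebra.Properties.Ring as RingProperties
import Algebra.Properties.Semiring.Exp as Exp
open import Data.Bool.Base using (true; false; if_then_else_)
open import Data.Fin.Base using (Fin; zero; suc; toℕ; inject₁; _<_; _≤_)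
open import Data.Fin.Permutation using (Permutation′; id; transpose; _⟨$⟩ˡ_; _⟨$⟩ʳ_; flip; inverseˡ; inverseʳ)
import Data.Fin.Permutation.Components as PC
open import Data.Fin.Properties using (_≟_; _≤?_; _<?_; all?; ≤-antisym; <-trans; <-cmp; <-irrefl)
open import Data.Integer.Base as ℤ using (ℤ)
open import Data.Integer.Tactic.RingSolver using (solve-∀)
open import Data.List.Base as List
  using (List; []; _∷_; _++_; map; filter; upTo; applyUpTo; allFin; cartesianProductWith)
open import Data.List.Membership.Propositional using (_∈_)
open import Data.List.Membership.Propositional.Properties using (∈-allFin; ∈-cartesianProductWith⁺)
open import Data.List.Properties using (map-upTo; map-tabulate)
open import Data.List.Relation.Unary.All as All using (All; []; _∷_)
open import Data.List.Relation.Unary.AllPairs using ([]; _∷_)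
open import Data.List.Relation.Unary.Any using (here; there)
open import Data.List.Relation.Unary.Unique.Propositional using (Unique)
open import Data.List.Relation.Unary.Unique.Propositional.Properties using (allFin⁺; cartesianProductWith⁺)
open import Data.Nat.Base using (ℕ; zero; suc; _∸_; z≤n; s≤s)
import Data.Nat.Properties as ℕ
open import Data.Product.Base using (_,_)
open import Data.Vec.Base using (Vec; []; _∷_; lookup; tabulate; _[_]≔_)
open import Data.Vec.Properties
  using (∷-injective; lookup∘tabulate; tabulate∘lookup; tabulate-cong; lookup∘update; lookup∘update′)
open import Function.Base using (_∘_)
open import Function.Bundles using (_⇔_; mk⇔; Equivalence)
open import Level using (Level; _⊔_)
open import Relation.Binary.Definitions using (DecidableEquality; tri<; tri≈; tri>)
open import Relation.Binary.PropositionalEquality as ≡ using (_≡_; _≢_; module ≡-Reasoning)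
open import Relation.Nullary using (¬_)
open import Relation.Nullary.Decidable using (Dec; does; yes; no; does-⇔; dec-true; dec-false)
open import Relation.Unary using (Pred; Decidable)

-- The substitution η_k = q(i) depends on the tail (η_{k+1}, ..., η_n) through q, and I_n is a
-- restricted set of tuples. Both difficulties go away once every sum is extended by zero to all of
-- `Fin n` and to all tuples: for a fixed tail the substitution permutes the whole index set, and
-- summands can be compared one at a time. In the induction the remaining indices k, ..., n are
-- listed by a map `e` into `Fin n`, so that the tensor positions keep ranging over `Fin n` while
-- the number of factors shrinks. The expansion takes place in an arbitrary ring with central
-- elements `γ k`, operators `op σ` that multiply like permutations, and elements `B t k` whose
-- position t is moved by conjugation with `op σ`. Series and matrices over the reflection algebra
-- provide such a ring. As the coefficients do not commute, the centrality of scalars has to be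
-- carried through both constructions.

private
  variable
    a b c ℓ r : Level
    X : Set a
    Y : Set b

-- Conditionals, and finite sums and products in a ring

if-yes : ∀ {P : Set r} {A : Set a} (P? : Dec P) {x y : A} → P → (if does P? then x else y) ≡ x
if-yes P? {x} {y} p = ≡.cong (λ b → if b then x else y) (dec-true P? p)

if-no : ∀ {P : Set r} {A : Set a} (P? : Dec P) {x y : A} → ¬ P → (if does P? then x else y) ≡ y
if-no P? {x} {y} ¬p = ≡.cong (λ b → if b then x else y) (dec-false P? ¬p)

module Sums (R : Ring c ℓ) where
  open Ring R
  open CommutativeSemigroupProperties +-commutativeSemigroup using (interchange)
  open import Relation.Binary.Reasoning.Setoid setoid

  ∑-cong : ∀ (xs : List X) {f g : X → Carrier} → (∀ x → f x ≈ g x) → ∑ rawRing xs f ≈ ∑ rawRing xs g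
  ∑-cong []       f≈g = refl
  ∑-cong (x ∷ xs) f≈g = +-cong (f≈g x) (∑-cong xs f≈g)

  ∑-map : ∀ (h : X → Y) xs (f : Y → Carrier) → ∑ rawRing (map h xs) f ≡ ∑ rawRing xs (f ∘ h)
  ∑-map h []       f = ≡.refl
  ∑-map h (x ∷ xs) f = ≡.cong (f (h x) +_) (∑-map h xs f)

  ∏-map : ∀ (h : X → Y) xs (f : Y → Carrier) → ∏ rawRing (map h xs) f ≡ ∏ rawRing xs (f ∘ h)
  ∏-map h []       f = ≡.refl
  ∏-map h (x ∷ xs) f = ≡.cong (f (h x) *_) (∏-map h xs f)

  ∑-++ : ∀ (xs ys : List X) (f : X → Carrier) → ∑ rawRing (xs ++ ys) f ≈ ∑ rawRing xs f + ∑ rawRing ys f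
  ∑-++ []       ys f = sym (+-identityˡ _)
  ∑-++ (x ∷ xs) ys f = trans (+-congˡ (∑-++ xs ys f)) (sym (+-assoc _ _ _))

  ∑-zero : ∀ {xs : List X} {f : X → Carrier} → All (λ x → f x ≈ 0#) xs → ∑ rawRing xs f ≈ 0#
  ∑-zero []            = refl
  ∑-zero (f≈0 ∷ all≈0) = trans (+-cong f≈0 (∑-zero all≈0)) (+-identityˡ 0#)

  ∑-+ : ∀ (xs : List X) (f g : X → Carrier) →
        ∑ rawRing xs (λ x → f x + g x) ≈ ∑ rawRing xs f + ∑ rawRing xs g
  ∑-+ []       f g = sym (+-identityˡ 0#)
  ∑-+ (x ∷ xs) f g = trans (+-congˡ (∑-+ xs f g)) (interchange _ _ _ _)

  ∑-*ˡ : ∀ (xs : List X) r (f : X → Carrier) → r * ∑ rawRing xs f ≈ ∑ rawRing xs (λ x → r * f x)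
  ∑-*ˡ []       r f = zeroʳ r
  ∑-*ˡ (x ∷ xs) r f = trans (distribˡ _ _ _) (+-congˡ (∑-*ˡ xs r f))

  ∑-*ʳ : ∀ (xs : List X) r (f : X → Carrier) → ∑ rawRing xs f * r ≈ ∑ rawRing xs (λ x → f x * r)
  ∑-*ʳ []       r f = zeroˡ r
  ∑-*ʳ (x ∷ xs) r f = trans (distribʳ _ _ _) (+-congˡ (∑-*ʳ xs r f))

  ∑-swap : ∀ (xs : List X) (ys : List Y) (f : X → Y → Carrier) →
           ∑ rawRing xs (λ x → ∑ rawRing ys (f x)) ≈ ∑ rawRing ys (λ y → ∑ rawRing xs (λ x → f x y))
  ∑-swap []       ys f = sym (∑-zero (All.universal (λ _ → refl) ys))
  ∑-swap (x ∷ xs) ys f = trans (+-congˡ (∑-swap xs ys f)) (sym (∑-+ ys _ _))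

  ∑-single : ∀ {xs : List X} {x} {f : X → Carrier} → Unique xs → x ∈ xs →
             (∀ y → y ≢ x → f y ≈ 0#) → ∑ rawRing xs f ≈ f x
  ∑-single (x∉xs ∷ _) (here ≡.refl) f≈0 =
    trans (+-congˡ (∑-zero (All.map (λ x≢y → f≈0 _ (x≢y ∘ ≡.sym)) x∉xs))) (+-identityʳ _)
  ∑-single (y∉xs ∷ xs!) (there x∈xs) f≈0 =
    trans (+-cong (f≈0 _ (All.lookup y∉xs x∈xs)) (∑-single xs! x∈xs f≈0)) (+-identityˡ _)

  -- Trades a restricted range for zero summands; the extended sum can be swapped, permuted and
  -- split into iterated sums.
  ∑-filter : ∀ {P : Pred X r} (P? : Decidable P) xs (f : X → Carrier) →
             ∑ rawRing (filter P? xs) f ≈ ∑ rawRing xs (λ x → if does (P? x) then f x else 0#)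
  ∑-filter P? []       f = refl
  ∑-filter P? (x ∷ xs) f with does (P? x)
  ... | true  = +-congˡ (∑-filter P? xs f)
  ... | false = trans (∑-filter P? xs f) (sym (+-identityˡ _))

  ∏-filter : ∀ {P : Pred X r} (P? : Decidable P) xs (f : X → Carrier) →
             ∏ rawRing (filter P? xs) f ≈ ∏ rawRing xs (λ x → if does (P? x) then f x else 1#)
  ∏-filter P? []       f = refl
  ∏-filter P? (x ∷ xs) f with does (P? x)
  ... | true  = *-congˡ (∏-filter P? xs f)
  ... | false = trans (∏-filter P? xs f) (sym (*-identityˡ _))

  ∑-cartesianProductWith : ∀ {Z : Set r} (h : X → Y → Z) xs ys (f : Z → Carrier) →
    ∑ rawRing (cartesianProductWith h xs ys) f ≈ ∑ rawRing xs (λ x → ∑ rawRing ys (λ y → f (h x y)))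
  ∑-cartesianProductWith h []       ys f = refl
  ∑-cartesianProductWith h (x ∷ xs) ys f = begin
    ∑ rawRing (map (h x) ys ++ cartesianProductWith h xs ys) f
      ≈⟨ ∑-++ (map (h x) ys) _ f ⟩
    ∑ rawRing (map (h x) ys) f + ∑ rawRing (cartesianProductWith h xs ys) f
      ≈⟨ +-cong (reflexive (∑-map (h x) ys f)) (∑-cartesianProductWith h xs ys f) ⟩
    ∑ rawRing ys (f ∘ h x) + ∑ rawRing xs (λ x → ∑ rawRing ys (f ∘ h x)) ∎

-- The ring of power series over a noncommutative ring

module PowerSeries (R : Ring c ℓ) where
  open Ring R
  open Sums R
  open CommutativeSemigroupProperties +-commutativeSemigroup using (x∙yz≈y∙xz)
  open import Relation.Binary.Reasoning.Setoid setoid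
  open RawRing (powerSeriesRing rawRing) using () renaming (_*_ to _⊛_; _≈_ to _≐_; 1# to 𝟙)

  ⊛-zero : ∀ f g → (f ⊛ g) 0 ≈ f 0 * g 0
  ⊛-zero f g = +-identityʳ _

  -- Splits off the summand i = 0. This recursion turns the laws of the Cauchy product into
  -- inductions on the exponent, without rearranging double sums.
  ⊛-sucˡ : ∀ f g s → (f ⊛ g) (suc s) ≈ f 0 * g (suc s) + ((f ∘ suc) ⊛ g) s
  ⊛-sucˡ f g s = +-congˡ (begin
    ∑ rawRing (applyUpTo suc (suc s)) F      ≡⟨ ≡.cong (λ xs → ∑ rawRing xs F) (map-upTo suc (suc s)) ⟨
    ∑ rawRing (map suc (upTo (suc s))) F     ≡⟨ ∑-map suc (upTo (suc s)) F ⟩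
    ((f ∘ suc) ⊛ g) s                        ∎)
    where
    F : ℕ → Carrier
    F i = f i * g (suc s ∸ i)

  -- Splits off the other extreme summand, i = s + 1. It is the mirror image that `⊛-comm` needs
  -- after exchanging the factors.
  ⊛-sucʳ : ∀ f g s → (f ⊛ g) (suc s) ≈ f (suc s) * g 0 + (f ⊛ (g ∘ suc)) s
  ⊛-sucʳ f g zero = begin
    (f ⊛ g) 1                              ≈⟨ ⊛-sucˡ f g 0 ⟩
    f 0 * g 1 + ((f ∘ suc) ⊛ g) 0          ≈⟨ +-congˡ (⊛-zero (f ∘ suc) g) ⟩
    f 0 * g 1 + f 1 * g 0                  ≈⟨ +-comm _ _ ⟩
    f 1 * g 0 + f 0 * g 1                  ≈⟨ +-congˡ (⊛-zero f (g ∘ suc)) ⟨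
    f 1 * g 0 + (f ⊛ (g ∘ suc)) 0          ∎
  ⊛-sucʳ f g (suc s) = begin
    (f ⊛ g) (suc (suc s))
      ≈⟨ ⊛-sucˡ f g (suc s) ⟩
    f 0 * g (suc (suc s)) + ((f ∘ suc) ⊛ g) (suc s)
      ≈⟨ +-congˡ (⊛-sucʳ (f ∘ suc) g s) ⟩
    f 0 * g (suc (suc s)) + (f (suc (suc s)) * g 0 + ((f ∘ suc) ⊛ (g ∘ suc)) s)
      ≈⟨ x∙yz≈y∙xz _ _ _ ⟩
    f (suc (suc s)) * g 0 + (f 0 * g (suc (suc s)) + ((f ∘ suc) ⊛ (g ∘ suc)) s)
      ≈⟨ +-congˡ (⊛-sucˡ f (g ∘ suc) s) ⟨
    f (suc (suc s)) * g 0 + (f ⊛ (g ∘ suc)) (suc s)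
      ∎

  ⊛-cong : ∀ {f f′ g g′} → f ≐ f′ → g ≐ g′ → (f ⊛ g) ≐ (f′ ⊛ g′)
  ⊛-cong f≐f′ g≐g′ s = ∑-cong (upTo (suc s)) (λ i → *-cong (f≐f′ i) (g≐g′ (s ∸ i)))

  ⊛-distribˡ : ∀ f g h s → (f ⊛ (λ t → g t + h t)) s ≈ (f ⊛ g) s + (f ⊛ h) s
  ⊛-distribˡ f g h s = trans (∑-cong (upTo (suc s)) (λ _ → distribˡ _ _ _)) (∑-+ (upTo (suc s)) _ _)

  ⊛-distribʳ : ∀ f g h s → ((λ t → g t + h t) ⊛ f) s ≈ (g ⊛ f) s + (h ⊛ f) s
  ⊛-distribʳ f g h s = trans (∑-cong (upTo (suc s)) (λ _ → distribʳ _ _ _)) (∑-+ (upTo (suc s)) _ _)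

  ⊛-scaleˡ : ∀ r f g s → ((λ t → r * f t) ⊛ g) s ≈ r * (f ⊛ g) s
  ⊛-scaleˡ r f g s = trans (∑-cong (upTo (suc s)) (λ _ → *-assoc _ _ _)) (sym (∑-*ˡ (upTo (suc s)) r _))

  -- The induction replaces f by its tail `f ∘ suc`, hence the quantification over f. The tail of
  -- `f ⊛ g` is itself a sum by `⊛-sucˡ`, whose two parts match the two parts of the right-hand
  -- side.
  ⊛-assoc : ∀ f g h → ((f ⊛ g) ⊛ h) ≐ (f ⊛ (g ⊛ h))
  ⊛-assoc f g h zero = begin
    ((f ⊛ g) ⊛ h) 0    ≈⟨ ⊛-zero (f ⊛ g) h ⟩
    (f ⊛ g) 0 * h 0    ≈⟨ *-congʳ (⊛-zero f g) ⟩
    f 0 * g 0 * h 0    ≈⟨ *-assoc _ _ _ ⟩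
    f 0 * (g 0 * h 0)  ≈⟨ *-congˡ (⊛-zero g h) ⟨
    f 0 * (g ⊛ h) 0    ≈⟨ ⊛-zero f (g ⊛ h) ⟨
    (f ⊛ (g ⊛ h)) 0    ∎
  ⊛-assoc f g h (suc s) = begin
    ((f ⊛ g) ⊛ h) (suc s)
      ≈⟨ ⊛-sucˡ (f ⊛ g) h s ⟩
    (f ⊛ g) 0 * h (suc s) + (((f ⊛ g) ∘ suc) ⊛ h) s
      ≈⟨ +-cong (*-congʳ (⊛-zero f g))
           (trans (⊛-cong {g = h} {g′ = h} (⊛-sucˡ f g) (λ _ → refl) s) (⊛-distribʳ h _ _ s)) ⟩
    f 0 * g 0 * h (suc s) + (((λ t → f 0 * g (suc t)) ⊛ h) s + (((f ∘ suc) ⊛ g) ⊛ h) s)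
      ≈⟨ +-cong (*-assoc _ _ _) (+-cong (⊛-scaleˡ (f 0) (g ∘ suc) h s) (⊛-assoc (f ∘ suc) g h s)) ⟩
    f 0 * (g 0 * h (suc s)) + (f 0 * ((g ∘ suc) ⊛ h) s + ((f ∘ suc) ⊛ (g ⊛ h)) s)
      ≈⟨ +-assoc _ _ _ ⟨
    f 0 * (g 0 * h (suc s)) + f 0 * ((g ∘ suc) ⊛ h) s + ((f ∘ suc) ⊛ (g ⊛ h)) s
      ≈⟨ +-congʳ (distribˡ _ _ _) ⟨
    f 0 * (g 0 * h (suc s) + ((g ∘ suc) ⊛ h) s) + ((f ∘ suc) ⊛ (g ⊛ h)) s
      ≈⟨ +-congʳ (*-congˡ (⊛-sucˡ g h s)) ⟨
    f 0 * (g ⊛ h) (suc s) + ((f ∘ suc) ⊛ (g ⊛ h)) s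
      ≈⟨ ⊛-sucˡ f (g ⊛ h) s ⟨
    (f ⊛ (g ⊛ h)) (suc s)
      ∎

  -- Centrality of the coefficients of one factor suffices. This covers the scalar series, and the
  -- unit, which yields the right identity law.
  ⊛-comm : ∀ f → (∀ i y → f i * y ≈ y * f i) → ∀ g → (f ⊛ g) ≐ (g ⊛ f)
  ⊛-comm f central g zero = begin
    (f ⊛ g) 0  ≈⟨ ⊛-zero f g ⟩
    f 0 * g 0  ≈⟨ central 0 (g 0) ⟩
    g 0 * f 0  ≈⟨ ⊛-zero g f ⟨
    (g ⊛ f) 0  ∎
  ⊛-comm f central g (suc s) = begin
    (f ⊛ g) (suc s)                       ≈⟨ ⊛-sucˡ f g s ⟩
    f 0 * g (suc s) + ((f ∘ suc) ⊛ g) s   ≈⟨ +-cong (central 0 _) (⊛-comm (f ∘ suc) (central ∘ suc) g s) ⟩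
    g (suc s) * f 0 + (g ⊛ (f ∘ suc)) s   ≈⟨ ⊛-sucʳ g f s ⟨
    (g ⊛ f) (suc s)                       ∎

  ⊛-zeroˡ : ∀ g s → ((λ _ → 0#) ⊛ g) s ≈ 0#
  ⊛-zeroˡ g s = ∑-zero (All.universal (λ _ → zeroˡ _) (upTo (suc s)))

  ⊛-identityˡ : ∀ g → (𝟙 ⊛ g) ≐ g
  ⊛-identityˡ g zero    = trans (⊛-zero 𝟙 g) (*-identityˡ _)
  ⊛-identityˡ g (suc s) = begin
    (𝟙 ⊛ g) (suc s)                             ≈⟨ ⊛-sucˡ 𝟙 g s ⟩
    1# * g (suc s) + ((λ _ → 0#) ⊛ g) s         ≈⟨ +-cong (*-identityˡ _) (⊛-zeroˡ g s) ⟩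
    g (suc s) + 0#                              ≈⟨ +-identityʳ _ ⟩
    g (suc s)                                   ∎

  𝟙-central : ∀ i y → 𝟙 i * y ≈ y * 𝟙 i
  𝟙-central zero    y = trans (*-identityˡ y) (sym (*-identityʳ y))
  𝟙-central (suc _) y = trans (zeroˡ y) (sym (zeroʳ y))

  -- The operations are left to be inferred from the laws, which makes them definitionally those of
  -- `powerSeriesRing`; results then apply to the statement without conversion.
  powerSeries : Ring c ℓ
  powerSeries = record
    { Carrier = ℕ → Carrier
    ; isRing  = record
      { +-isAbelianGroup = Pointwise.isAbelianGroup ℕ +-isAbelianGroup
      ; *-cong           = ⊛-cong
      ; *-assoc          = ⊛-assoc
      ; *-identity       = ⊛-identityˡ , λ g s → trans (sym (⊛-comm 𝟙 𝟙-central g s)) (⊛-identityˡ g s)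
      ; distrib          = ⊛-distribˡ , ⊛-distribʳ
      }
    }

-- The matrix ring and its scalar matrices

module Matrices (R : Ring c ℓ) {I : Set a} (_≟_ : DecidableEquality I) (indices : List I)
  (complete : ∀ i → i ∈ indices) (unique : Unique indices) where
  open Ring R
  open Sums R
  open import Relation.Binary.Reasoning.Setoid setoid
  open RawRing (matrixRing rawRing _≟_ indices) using () renaming (_*_ to _⊡_; _≈_ to _≐_; 1# to 𝟙; Carrier to Mat)

  -- Allows any test with a single solution, since the entries of a permutation operator test
  -- `I ≟ᵛ permute σ v` in the summation variable v.
  ∑-indicator : ∀ {P : Pred I r} (P? : Decidable P) {k} → P k → (∀ {j} → P j → j ≡ k) →
                ∀ (f : I → Carrier) → ∑ rawRing indices (λ j → if does (P? j) then f j else 0#) ≈ f k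
  ∑-indicator P? {k} Pk P⇒≡k f = trans (∑-single unique (complete k) off) on
    where
    off : ∀ j → j ≢ k → (if does (P? j) then f j else 0#) ≈ 0#
    off j j≢k = reflexive (if-no (P? j) (j≢k ∘ P⇒≡k))

    on : (if does (P? k) then f k else 0#) ≈ f k
    on = reflexive (if-yes (P? k) Pk)

  if-*ˡ : ∀ b y → (if b then 1# else 0#) * y ≈ (if b then y else 0#)
  if-*ˡ true  y = *-identityˡ y
  if-*ˡ false y = zeroˡ y

  if-*ʳ : ∀ b y → y * (if b then 1# else 0#) ≈ (if b then y else 0#)
  if-*ʳ true  y = *-identityʳ y
  if-*ʳ false y = zeroʳ y

  ⊡-identityˡ : ∀ M → (𝟙 ⊡ M) ≐ M
  ⊡-identityˡ M i j = trans (∑-cong indices (λ k → if-*ˡ (does (i ≟ k)) (M k j)))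
    (∑-indicator (i ≟_) ≡.refl ≡.sym (λ k → M k j))

  ⊡-identityʳ : ∀ M → (M ⊡ 𝟙) ≐ M
  ⊡-identityʳ M i j = trans (∑-cong indices (λ k → if-*ʳ (does (k ≟ j)) (M i k)))
    (∑-indicator (_≟ j) ≡.refl (λ eq → eq) (M i))

  ⊡-assoc : ∀ L M N → ((L ⊡ M) ⊡ N) ≐ (L ⊡ (M ⊡ N))
  ⊡-assoc L M N i j = begin
    ∑ rawRing indices (λ k → ∑ rawRing indices (λ h → L i h * M h k) * N k j)
      ≈⟨ ∑-cong indices (λ k → trans (∑-*ʳ indices _ _) (∑-cong indices (λ _ → *-assoc _ _ _))) ⟩
    ∑ rawRing indices (λ k → ∑ rawRing indices (λ h → L i h * (M h k * N k j)))
      ≈⟨ ∑-swap indices indices _ ⟩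
    ∑ rawRing indices (λ h → ∑ rawRing indices (λ k → L i h * (M h k * N k j)))
      ≈⟨ ∑-cong indices (λ h → ∑-*ˡ indices _ _) ⟨
    ∑ rawRing indices (λ h → L i h * ∑ rawRing indices (λ k → M h k * N k j))
      ∎

  scale : Carrier → Mat → Mat
  scale y M i j = y * M i j

  -- Turns multiplication by a scalar into multiplication by a ring element, so that coefficients
  -- and operators live in one ring.
  scale-⊡ : ∀ y M → scale y M ≐ (scale y 𝟙 ⊡ M)
  scale-⊡ y M i j = begin
    y * M i j                                          ≈⟨ *-congˡ (⊡-identityˡ M i j) ⟨
    y * ∑ rawRing indices (λ k → 𝟙 i k * M k j)        ≈⟨ ∑-*ˡ indices y _ ⟩
    ∑ rawRing indices (λ k → y * (𝟙 i k * M k j))      ≈⟨ ∑-cong indices (λ k → *-assoc _ _ _) ⟨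
    ∑ rawRing indices (λ k → y * 𝟙 i k * M k j)        ∎

  scale-central : ∀ {y} → (∀ z → y * z ≈ z * y) → ∀ M → (scale y 𝟙 ⊡ M) ≐ (M ⊡ scale y 𝟙)
  scale-central {y} central M i j = begin
    ∑ rawRing indices (λ k → y * 𝟙 i k * M k j)        ≈⟨ scale-⊡ y M i j ⟨
    y * M i j                                          ≈⟨ *-congˡ (⊡-identityʳ M i j) ⟨
    y * ∑ rawRing indices (λ k → M i k * 𝟙 k j)        ≈⟨ ∑-*ˡ indices y _ ⟩
    ∑ rawRing indices (λ k → y * (M i k * 𝟙 k j))      ≈⟨ ∑-cong indices (λ k → commute k) ⟩
    ∑ rawRing indices (λ k → M i k * (y * 𝟙 k j))      ∎
    where
    commute : ∀ k → y * (M i k * 𝟙 k j) ≈ M i k * (y * 𝟙 k j)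
    commute k = trans (sym (*-assoc _ _ _)) (trans (*-congʳ (central (M i k))) (*-assoc _ _ _))

  matrices : Ring (a ⊔ c) (a ⊔ ℓ)
  matrices = record
    { Carrier = Mat
    ; isRing  = record
      { +-isAbelianGroup = Pointwise.isAbelianGroup I (Pointwise.isAbelianGroup I +-isAbelianGroup)
      ; *-cong           = λ L≐M N≐Q i j → ∑-cong indices (λ k → *-cong (L≐M i k) (N≐Q k j))
      ; *-assoc          = ⊡-assoc
      ; *-identity       = ⊡-identityˡ , ⊡-identityʳ
      ; distrib          = (λ L M N i j → trans (∑-cong indices (λ _ → distribˡ _ _ _)) (∑-+ indices _ _))
                         , (λ L M N i j → trans (∑-cong indices (λ _ → distribʳ _ _ _)) (∑-+ indices _ _))
      }
    }

-- Permutation operators on tensor powers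

∈-tuples : ∀ {n k} (v : Vec (Fin n) k) → v ∈ tuples n k
∈-tuples []      = here ≡.refl
∈-tuples (i ∷ v) = ∈-cartesianProductWith⁺ _∷_ (∈-allFin i) (∈-tuples v)

tuples-unique : ∀ n k → Unique (tuples n k)
tuples-unique n zero    = [] ∷ []
tuples-unique n (suc k) = cartesianProductWith⁺ _∷_ ∷-injective (allFin⁺ n) (tuples-unique n k)

lookup-injective : ∀ {A : Set} {n} {u v : Vec A n} → (∀ t → lookup u t ≡ lookup v t) → u ≡ v
lookup-injective {u = u} {v} eq = ≡.trans (≡.sym (tabulate∘lookup u)) (≡.trans (tabulate-cong eq) (tabulate∘lookup v))

-- The action on basis indices: the operator of σ sends e_J to the basis vector indexed by
-- `permute σ J`.
permute : ∀ {A : Set} {k} → Permutation′ k → Vec A k → Vec A k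
permute σ v = tabulate (λ t → lookup v (σ ⟨$⟩ˡ t))

permute-inverseˡ : ∀ {A : Set} {k} (σ : Permutation′ k) (v : Vec A k) → permute (flip σ) (permute σ v) ≡ v
permute-inverseˡ σ v = lookup-injective λ t → begin
  lookup (permute (flip σ) (permute σ v)) t  ≡⟨ lookup∘tabulate _ t ⟩
  lookup (permute σ v) (σ ⟨$⟩ʳ t)            ≡⟨ lookup∘tabulate _ (σ ⟨$⟩ʳ t) ⟩
  lookup v (σ ⟨$⟩ˡ (σ ⟨$⟩ʳ t))               ≡⟨ ≡.cong (lookup v) (inverseˡ σ) ⟩
  lookup v t                                 ∎
  where open ≡-Reasoning

-- Position t of `permute (flip σ) v` reads position σ(t) of v, so the two updates hit the same
-- entry.
permute-update : ∀ {A : Set} {k} (σ : Permutation′ k) (v : Vec A k) t y →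
                 permute (flip σ) (v [ σ ⟨$⟩ʳ t ]≔ y) ≡ permute (flip σ) v [ t ]≔ y
permute-update σ v t y = lookup-injective pointwise
  where
  open ≡-Reasoning

  pointwise : ∀ i → lookup (permute (flip σ) (v [ σ ⟨$⟩ʳ t ]≔ y)) i ≡ lookup (permute (flip σ) v [ t ]≔ y) i
  pointwise i with i ≟ t
  ... | yes ≡.refl = begin
    lookup (permute (flip σ) (v [ σ ⟨$⟩ʳ t ]≔ y)) t  ≡⟨ lookup∘tabulate _ t ⟩
    lookup (v [ σ ⟨$⟩ʳ t ]≔ y) (σ ⟨$⟩ʳ t)            ≡⟨ lookup∘update (σ ⟨$⟩ʳ t) v y ⟩
    y                                                ≡⟨ lookup∘update t (permute (flip σ) v) y ⟨
    lookup (permute (flip σ) v [ t ]≔ y) t           ∎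
  ... | no i≢t = begin
    lookup (permute (flip σ) (v [ σ ⟨$⟩ʳ t ]≔ y)) i  ≡⟨ lookup∘tabulate _ i ⟩
    lookup (v [ σ ⟨$⟩ʳ t ]≔ y) (σ ⟨$⟩ʳ i)            ≡⟨ lookup∘update′ σi≢σt v y ⟩
    lookup v (σ ⟨$⟩ʳ i)                              ≡⟨ lookup∘tabulate _ i ⟨
    lookup (permute (flip σ) v) i                    ≡⟨ lookup∘update′ i≢t (permute (flip σ) v) y ⟨
    lookup (permute (flip σ) v [ t ]≔ y) i           ∎
    where
    σi≢σt : σ ⟨$⟩ʳ i ≢ σ ⟨$⟩ʳ t
    σi≢σt eq = i≢t (≡.trans (≡.sym (inverseˡ σ)) (≡.trans (≡.cong (σ ⟨$⟩ˡ_) eq) (inverseˡ σ)))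

module TensorEnd (R : Ring c ℓ) (n k : ℕ) where
  open Ring R
  open Matrices R _≟ᵛ_ (tuples n k) ∈-tuples (tuples-unique n k) public
  open Sums R
  open RawRing (tensorEnd rawRing n k) using () renaming (_*_ to _⊡_; _≈_ to _≐_; 1# to 𝟙)
  open import Relation.Binary.Reasoning.Setoid setoid

  operator : Permutation′ k → Vec (Fin n) k → Vec (Fin n) k → Carrier
  operator = permutationOperator rawRing {n} {k}

  operator-⊡ : ∀ σ M I J → (operator σ ⊡ M) I J ≈ M (permute (flip σ) I) J
  operator-⊡ σ M I J =
    trans (∑-cong (tuples n k) (λ v → if-*ˡ (does (I ≟ᵛ permute σ v)) (M v J)))
      (∑-indicator (λ v → I ≟ᵛ permute σ v) (≡.sym (permute-inverseˡ (flip σ) I))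
        (λ { ≡.refl → ≡.sym (permute-inverseˡ σ _) }) (λ v → M v J))

  ⊡-operator : ∀ σ M I J → (M ⊡ operator σ) I J ≈ M I (permute σ J)
  ⊡-operator σ M I J =
    trans (∑-cong (tuples n k) (λ v → if-*ʳ (does (v ≟ᵛ permute σ J)) (M I v)))
      (∑-indicator (λ v → v ≟ᵛ permute σ J) ≡.refl (λ eq → eq) (M I))

  indicator-cong : ∀ I {u v : Vec (Fin n) k} → u ≡ v →
    (if does (I ≟ᵛ u) then 1# else 0#) ≈ (if does (I ≟ᵛ v) then 1# else 0#)
  indicator-cong I ≡.refl = refl

  -- A permutation carries proofs besides its two maps, so equal values need not give
  -- propositionally equal permutations. Only the inverse map enters the matrix.
  operator-cong : ∀ σ τ → (∀ t → σ ⟨$⟩ˡ t ≡ τ ⟨$⟩ˡ t) → operator σ ≐ operator τ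
  operator-cong σ τ eq I J = indicator-cong I (tabulate-cong (λ t → ≡.cong (lookup J) (eq t)))

  operator-id : operator id ≐ 𝟙
  operator-id I J = indicator-cong I (tabulate∘lookup J)

  operator-· : ∀ σ τ → (operator σ ⊡ operator τ) ≐ operator (σ · τ)
  operator-· σ τ I J = trans (⊡-operator τ (operator σ) I J)
    (indicator-cong I (tabulate-cong (λ t → lookup∘tabulate _ (σ ⟨$⟩ˡ t))))

  -- As σ carries factor t to position σ(t), acting there after σ is acting at t before σ. In
  -- entries, both sides evaluate X at the same indices, and `permute σ` carries one agreement test
  -- to the other.
  at-operator : ∀ X σ t → (_at_ rawRing X (σ ⟨$⟩ʳ t) ⊡ operator σ) ≐ (operator σ ⊡ _at_ rawRing X t)
  at-operator X σ t I J = begin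
    (_at_ rawRing X s ⊡ operator σ) I J
      ≈⟨ ⊡-operator σ (_at_ rawRing X s) I J ⟩
    entry (does ((I [ s ]≔ lookup (permute σ J) s) ≟ᵛ permute σ J)) (lookup I s) (lookup (permute σ J) s)
      ≡⟨ ≡.cong (λ y → entry (does ((I [ s ]≔ y) ≟ᵛ permute σ J)) (lookup I s) y)
           (≡.trans (lookup∘tabulate _ s) (≡.cong (lookup J) (inverseˡ σ))) ⟩
    entry (does ((I [ s ]≔ lookup J t) ≟ᵛ permute σ J)) (lookup I s) (lookup J t)
      ≡⟨ ≡.cong₂ (λ b i → entry b i (lookup J t)) (does-⇔ (mk⇔ to from) (_ ≟ᵛ _) (_ ≟ᵛ _))
           (≡.sym (lookup∘tabulate _ t)) ⟩
    entry (does ((permute (flip σ) I [ t ]≔ lookup J t) ≟ᵛ J)) (lookup (permute (flip σ) I) t) (lookup J t)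
      ≈⟨ operator-⊡ σ (_at_ rawRing X t) I J ⟨
    (operator σ ⊡ _at_ rawRing X t) I J
      ∎
    where
    s : Fin k
    s = σ ⟨$⟩ʳ t

    entry = λ b i j → if b then X i j else 0#

    to : I [ s ]≔ lookup J t ≡ permute σ J → permute (flip σ) I [ t ]≔ lookup J t ≡ J
    to eq = ≡.trans (≡.sym (permute-update σ I t _)) (≡.trans (≡.cong (permute (flip σ)) eq) (permute-inverseˡ σ J))

    from : permute (flip σ) I [ t ]≔ lookup J t ≡ J → I [ s ]≔ lookup J t ≡ permute σ J
    from eq = ≡.trans (≡.sym (permute-inverseˡ (flip σ) _)) (≡.cong (permute σ) (≡.trans (permute-update σ I t _) eq))

-- Values of transpositions

transpose-matchˡ : ∀ {n} (i j : Fin n) → PC.transpose i j i ≡ j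
transpose-matchˡ i j rewrite dec-true (i ≟ i) ≡.refl = ≡.refl

transpose-mismatch : ∀ {n} {i j k : Fin n} → k ≢ i → k ≢ j → PC.transpose i j k ≡ k
transpose-mismatch {i = i} {j} {k} k≢i k≢j
  rewrite dec-false (k ≟ i) k≢i | dec-false (k ≟ j) k≢j = ≡.refl

transpose-matchʳ : ∀ {n} (i j : Fin n) → PC.transpose i j j ≡ i
transpose-matchʳ i j with j ≟ i
... | yes j≡i = j≡i
... | no  _   rewrite dec-true (j ≟ j) ≡.refl = ≡.refl

-- The inverse map of `transpose i j` is `PC.transpose j i`, so identifying a transposition with its
-- inverse comes down to this symmetry.
transpose-comm : ∀ {n} (i j k : Fin n) → PC.transpose i j k ≡ PC.transpose j i k
transpose-comm i j k = cases (k ≟ i) (k ≟ j)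
  where
  cases : Dec (k ≡ i) → Dec (k ≡ j) → PC.transpose i j k ≡ PC.transpose j i k
  cases (yes ≡.refl) _            = ≡.trans (transpose-matchˡ i j) (≡.sym (transpose-matchʳ j i))
  cases (no _)       (yes ≡.refl) = ≡.trans (transpose-matchʳ i j) (≡.sym (transpose-matchˡ j i))
  cases (no k≢i)     (no k≢j)     = ≡.trans (transpose-mismatch k≢i k≢j) (≡.sym (transpose-mismatch k≢j k≢i))

-- Makes the identity in Π_k the operator of the transposition (k k).
transpose-self : ∀ {n} (i k : Fin n) → PC.transpose i i k ≡ k
transpose-self i k = cases (k ≟ i)
  where
  cases : Dec (k ≡ i) → PC.transpose i i k ≡ k
  cases (yes ≡.refl) = transpose-matchˡ i i
  cases (no k≢i)     = transpose-mismatch k≢i k≢i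

⟨$⟩ʳ-injective : ∀ {n} (σ : Permutation′ n) {i j} → σ ⟨$⟩ʳ i ≡ σ ⟨$⟩ʳ j → i ≡ j
⟨$⟩ʳ-injective σ eq = ≡.trans (≡.sym (inverseˡ σ)) (≡.trans (≡.cong (σ ⟨$⟩ˡ_) eq) (inverseˡ σ))

-- By injectivity no point of Q can be sent to a fixed point outside Q. Used for the indices that
-- are at least k and for those greater than k.
fixes-complement⇒stable : ∀ {n} {Q : Pred (Fin n) r} (Q? : Decidable Q) (σ : Permutation′ n) →
                   (∀ t → ¬ Q t → σ ⟨$⟩ʳ t ≡ t) → ∀ x → Q (σ ⟨$⟩ˡ x) ⇔ Q x
fixes-complement⇒stable {Q = Q} Q? σ fixes x = mk⇔ to from
  where
  to : Q (σ ⟨$⟩ˡ x) → Q x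
  to Qi with Q? x
  ... | yes Qx = Qx
  ... | no ¬Qx = ≡.subst Q (⟨$⟩ʳ-injective σ (≡.trans (inverseʳ σ) (≡.sym (fixes x ¬Qx)))) Qi

  from : Q x → Q (σ ⟨$⟩ˡ x)
  from Qx with Q? (σ ⟨$⟩ˡ x)
  ... | yes Qi = Qi
  ... | no ¬Qi = ≡.subst Q (≡.trans (≡.sym (inverseʳ σ)) (fixes _ ¬Qi)) Qx

-- The permutations p^[i] and their fixed points

module _ {n : ℕ} where

  -- The permutation p^[i] of η, when e lists i, i+1, …, n.
  straighten : ∀ {k} → (Fin k → Fin n) → Vec (Fin n) k → Permutation′ n
  straighten {zero}  e η = id
  straighten {suc k} e η =
    descend k id (λ j q → q · transpose (e (inject₁ j)) (q ⟨$⟩ˡ lookup η (inject₁ j))) zero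

  Increasing : ∀ {k} → (Fin k → Fin n) → Set
  Increasing e = ∀ {i j} → i < j → e i < e j

  -- Quantifying over any greatest j makes the condition vacuous for an empty `e`.
  PreservesMaximum : ∀ {k} → (Fin k → Fin n) → Set
  PreservesMaximum {k} e = ∀ j → (∀ (i : Fin k) → i ≤ j) → ∀ (x : Fin n) → x ≤ e j

  -- With the identity for `e`, filtering by this test gives `I n` by definition.
  admissible? : ∀ {k} (e : Fin k → Fin n) → Decidable (λ (η : Vec (Fin n) k) → ∀ j → e j ≤ lookup η j)
  admissible? e η = all? (λ j → e j ≤? lookup η j)

  -- The transposition added for the entry x moves only `e zero` and q⁻¹(x). If the latter were t,
  -- then x = q(t) = t would lie below `e zero`, against admissibility.
  straighten-fixes : ∀ {k} (e : Fin (suc k) → Fin n) η → Increasing e → (∀ j → e j ≤ lookup η j) →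
                     ∀ t → t < e zero → straighten e η ⟨$⟩ʳ t ≡ t
  straighten-fixes {zero}  e η       inc adm t t<e = ≡.refl
  straighten-fixes {suc k} e (x ∷ η) inc adm t t<e =
    ≡.trans (≡.cong (q ⟨$⟩ʳ_) (transpose-mismatch t≢e t≢i)) qt≡t
    where
    q : Permutation′ n
    q = straighten (e ∘ suc) η

    qt≡t : q ⟨$⟩ʳ t ≡ t
    qt≡t = straighten-fixes (e ∘ suc) η (λ i<j → inc (s≤s i<j)) (adm ∘ suc) t (<-trans t<e (inc (s≤s z≤n)))

    t≢e : t ≢ e zero
    t≢e t≡e = <-irrefl t≡e t<e

    t≢i : t ≢ q ⟨$⟩ˡ x
    t≢i ≡.refl = ℕ.<⇒≱ t<e (≡.subst (e zero ≤_) (≡.trans (≡.sym (inverseʳ q)) qt≡t) (adm zero))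

p-straighten : ∀ {n} (η : Vec (Fin n) n) → p η ≡ straighten (λ i → i) η
p-straighten {zero}  η = ≡.refl
p-straighten {suc n} η = ≡.refl

-- Expansion of the bracket in an abstract ring

module Expanding (E : Ring c ℓ) (n : ℕ) where
  open Ring E hiding (zero)
  open Sums E
  open import Relation.Binary.Reasoning.Setoid setoid
  open CommutativeMonoidSum +-commutativeMonoid using (sum; sum-permute)

  ∑-tabulate : ∀ {A : Set a} {k} (g : Fin k → A) (f : A → Carrier) →
               ∑ rawRing (List.tabulate g) f ≡ sum (f ∘ g)
  ∑-tabulate {k = zero}  g f = ≡.refl
  ∑-tabulate {k = suc k} g f = ≡.cong (f (g zero) +_) (∑-tabulate (g ∘ suc) f)

  ∑-permute : ∀ (σ : Permutation′ n) f → ∑ rawRing (allFin n) f ≈ ∑ rawRing (allFin n) (f ∘ (σ ⟨$⟩ʳ_))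
  ∑-permute σ f = begin
    ∑ rawRing (allFin n) f                 ≡⟨ ∑-tabulate (λ i → i) f ⟩
    sum f                                  ≈⟨ sum-permute f σ ⟩
    sum (f ∘ (σ ⟨$⟩ʳ_))                    ≡⟨ ∑-tabulate (λ i → i) (f ∘ (σ ⟨$⟩ʳ_)) ⟨
    ∑ rawRing (allFin n) (f ∘ (σ ⟨$⟩ʳ_))   ∎

  ∏-allFin-suc : ∀ k (f : Fin (suc k) → Carrier) →
                 ∏ rawRing (allFin (suc k)) f ≡ f zero * ∏ rawRing (allFin k) (f ∘ suc)
  ∏-allFin-suc k f = ≡.cong (f zero *_) (≡.trans
    (≡.cong (λ xs → ∏ rawRing xs f) (≡.sym (map-tabulate (λ i → i) suc))) (∏-map suc (allFin k) f))

  Central : Carrier → Set _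
  Central z = ∀ y → z * y ≈ y * z

  ∏-central : ∀ {A : Set a} (xs : List A) {f : A → Carrier} → (∀ x → Central (f x)) → Central (∏ rawRing xs f)
  ∏-central []       central y = trans (*-identityˡ y) (sym (*-identityʳ y))
  ∏-central (x ∷ xs) {f} central y = begin
    f x * ∏ rawRing xs f * y     ≈⟨ *-assoc _ _ _ ⟩
    f x * (∏ rawRing xs f * y)   ≈⟨ *-congˡ (∏-central xs central y) ⟩
    f x * (y * ∏ rawRing xs f)   ≈⟨ *-assoc _ _ _ ⟨
    f x * y * ∏ rawRing xs f     ≈⟨ *-congʳ (central x y) ⟩
    y * f x * ∏ rawRing xs f     ≈⟨ *-assoc _ _ _ ⟩
    y * (f x * ∏ rawRing xs f)   ∎

  module Interlacing
    (op : Permutation′ n → Carrier) (B : (t k : Fin n) → Carrier) (γ : Fin n → Carrier)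
    (γ-central : ∀ k y → γ k * y ≈ y * γ k)
    (op-cong : ∀ σ τ → (∀ t → σ ⟨$⟩ˡ t ≡ τ ⟨$⟩ˡ t) → op σ ≈ op τ)
    (op-id : op id ≈ 1#)
    (op-· : ∀ σ τ → op σ * op τ ≈ op (σ · τ))
    (B-op : ∀ σ t k → B (σ ⟨$⟩ʳ t) k * op σ ≈ op σ * B t k)
    where

    Π : Fin n → Carrier
    Π k = 1# + γ k * ∑ rawRing (filter (k <?_) (allFin n)) (λ i → op (transpose k i))

    bracket : ∀ {k} → (Fin k → Fin n) → Carrier
    bracket {zero}        e = 1#
    bracket {suc zero}    e = B (e zero) (e zero)
    bracket {suc (suc k)} e = B (e zero) (e zero) * Π (e zero) * bracket (e ∘ suc)

    weight : ∀ {k} → (Fin k → Fin n) → Vec (Fin n) k → Carrier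
    weight {k} e η = ∏ rawRing (filter (λ j → e j <? lookup η j) (allFin k)) (γ ∘ e)

    factors : ∀ {k} → (Fin k → Fin n) → Vec (Fin n) k → Carrier
    factors {k} e η = ∏ rawRing (allFin k) (λ j → B (lookup η j) (e j))

    term : ∀ {k} → (Fin k → Fin n) → Vec (Fin n) k → Carrier
    term e η = weight e η * (op (flip (straighten e η)) * factors e η)

    -- Plays two roles: the coefficient of (k i) in Π_k, and the factor that η_k = i contributes to
    -- α. The value 1 for i < k is harmless, because `summand` and `guarded` vanish there.
    coefficientOf : Fin n → Fin n → Carrier
    coefficientOf k i = if does (k <? i) then γ k else 1#

    coefficientOf-central : ∀ k i → Central (coefficientOf k i)
    coefficientOf-central k i y with does (k <? i)
    ... | true  = γ-central k y
    ... | false = trans (*-identityˡ y) (sym (*-identityʳ y))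

    weight-∷ : ∀ {k} (e : Fin (suc k) → Fin n) x η →
               weight e (x ∷ η) ≈ coefficientOf (e zero) x * weight (e ∘ suc) η
    weight-∷ {k} e x η = begin
      weight e (x ∷ η)
        ≈⟨ ∏-filter (λ j → e j <? lookup (x ∷ η) j) (allFin (suc k)) (γ ∘ e) ⟩
      ∏ rawRing (allFin (suc k)) (λ j → coefficientOf (e j) (lookup (x ∷ η) j))
        ≡⟨ ∏-allFin-suc k _ ⟩
      coefficientOf (e zero) x * ∏ rawRing (allFin k) (λ j → coefficientOf (e (suc j)) (lookup η j))
        ≈⟨ *-congˡ (∏-filter (λ j → e (suc j) <? lookup η j) (allFin k) (γ ∘ e ∘ suc)) ⟨
      coefficientOf (e zero) x * weight (e ∘ suc) η
        ∎

    summand : Fin n → Fin n → Carrier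
    summand k i = if does (k ≤? i) then coefficientOf k i * op (transpose k i) else 0#

    Π-∑ : ∀ k → Π k ≈ ∑ rawRing (allFin n) (summand k)
    Π-∑ k = sym (begin
      ∑ rawRing (allFin n) (summand k)
        ≈⟨ ∑-cong (allFin n) split ⟩
      ∑ rawRing (allFin n) (λ i → diagonal i + upper i)
        ≈⟨ ∑-+ (allFin n) diagonal upper ⟩
      ∑ rawRing (allFin n) diagonal + ∑ rawRing (allFin n) upper
        ≈⟨ +-cong (trans (∑-single (allFin⁺ n) (∈-allFin k) diagonal-off) (reflexive (if-yes (k ≟ k) ≡.refl))) (begin
             ∑ rawRing (allFin n) upper
               ≈⟨ ∑-filter (k <?_) (allFin n) _ ⟨
             ∑ rawRing (filter (k <?_) (allFin n)) (λ i → γ k * op (transpose k i))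
               ≈⟨ ∑-*ˡ (filter (k <?_) (allFin n)) (γ k) _ ⟨
             γ k * ∑ rawRing (filter (k <?_) (allFin n)) (λ i → op (transpose k i))
               ∎) ⟩
      Π k ∎)
      where
      τ diagonal upper : Fin n → Carrier
      τ i        = op (transpose k i)
      diagonal i = if does (k ≟ i) then 1# else 0#
      upper i    = if does (k <? i) then γ k * τ i else 0#

      diagonal-off : ∀ i → i ≢ k → diagonal i ≈ 0#
      diagonal-off i i≢k = reflexive (if-no (k ≟ i) (i≢k ∘ ≡.sym))

      split : ∀ i → summand k i ≈ diagonal i + upper i
      split i with <-cmp k i
      ... | tri< k<i k≢i _ = begin
        summand k i                        ≡⟨ if-yes (k ≤? i) (ℕ.<⇒≤ k<i) ⟩
        coefficientOf k i * τ i            ≡⟨ ≡.cong (_* τ i) (if-yes (k <? i) k<i) ⟩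
        γ k * τ i                          ≈⟨ +-identityˡ _ ⟨
        0# + γ k * τ i                     ≡⟨ ≡.cong₂ _+_ (if-no (k ≟ i) k≢i) (if-yes (k <? i) k<i) ⟨
        diagonal i + upper i               ∎
      ... | tri≈ k≮k ≡.refl _ = begin
        summand k k                        ≡⟨ if-yes (k ≤? k) ℕ.≤-refl ⟩
        coefficientOf k k * τ k            ≈⟨ *-cong (reflexive (if-no (k <? k) k≮k))
                                                (trans (op-cong (transpose k k) id (transpose-self k)) op-id) ⟩
        1# * 1#                            ≈⟨ *-identityˡ 1# ⟩
        1#                                 ≈⟨ +-identityʳ 1# ⟨
        1# + 0#                            ≡⟨ ≡.cong₂ _+_ (if-yes (k ≟ k) ≡.refl) (if-no (k <? k) k≮k) ⟨
        diagonal k + upper k               ∎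
      ... | tri> k≮i k≢i i<k = begin
        summand k i                        ≡⟨ if-no (k ≤? i) (ℕ.<⇒≱ i<k) ⟩
        0#                                 ≈⟨ +-identityˡ 0# ⟨
        0# + 0#                            ≡⟨ ≡.cong₂ _+_ (if-no (k ≟ i) k≢i) (if-no (k <? i) k≮i) ⟨
        diagonal i + upper i               ∎

    -- The central elements ω and w move to the front, which brings τ next to ρ. At least two values
    -- of `e` are required because a single one adds no transposition to `straighten`.
    term-∷ : ∀ {k} (e : Fin (suc (suc k)) → Fin n) x η → let i = straighten (e ∘ suc) η ⟨$⟩ˡ x in
             coefficientOf (e zero) i ≡ coefficientOf (e zero) x →
             B (e zero) (e zero) * (coefficientOf (e zero) i * op (transpose (e zero) i)) * term (e ∘ suc) η
               ≈ term e (x ∷ η)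
    term-∷ {k} e x η same = begin
      β * (ω * τ) * (w * (ρ * π))             ≈⟨ *-congʳ (*-congˡ (ω-central τ)) ⟩
      β * (τ * ω) * (w * (ρ * π))             ≈⟨ *-congʳ (*-assoc _ _ _) ⟨
      β * τ * ω * (w * (ρ * π))               ≈⟨ *-congʳ (ω-central (β * τ)) ⟨
      ω * (β * τ) * (w * (ρ * π))             ≈⟨ *-assoc _ _ _ ⟩
      ω * (β * τ * (w * (ρ * π)))             ≈⟨ *-congˡ (*-assoc _ _ _) ⟨
      ω * (β * τ * w * (ρ * π))               ≈⟨ *-congˡ (*-congʳ (w-central (β * τ))) ⟨
      ω * (w * (β * τ) * (ρ * π))             ≈⟨ *-congˡ (*-assoc _ _ _) ⟩
      ω * (w * (β * τ * (ρ * π)))             ≈⟨ *-assoc _ _ _ ⟨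
      ω * w * (β * τ * (ρ * π))               ≈⟨ *-congˡ (*-assoc _ _ _) ⟨
      ω * w * (β * τ * ρ * π)                 ≈⟨ *-congˡ (*-congʳ (*-assoc _ _ _)) ⟩
      ω * w * (β * (τ * ρ) * π)               ≈⟨ *-congˡ (*-congʳ (*-congˡ τρ)) ⟩
      ω * w * (β * op (flip σ) * π)           ≈⟨ *-congˡ (*-congʳ βσ) ⟩
      ω * w * (op (flip σ) * B x (e zero) * π) ≈⟨ *-congˡ (*-assoc _ _ _) ⟩
      ω * w * (op (flip σ) * (B x (e zero) * π))
        ≈⟨ *-cong (trans (*-congʳ (reflexive same)) (sym (weight-∷ e x η)))
             (*-congˡ (reflexive (≡.sym (∏-allFin-suc (suc k) (λ j → B (lookup (x ∷ η) j) (e j)))))) ⟩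
      weight e (x ∷ η) * (op (flip σ) * factors e (x ∷ η))
        ∎
      where
      q σ : Permutation′ n
      q = straighten (e ∘ suc) η
      σ = straighten e (x ∷ η)

      i : Fin n
      i = q ⟨$⟩ˡ x

      β ω τ w ρ π : Carrier
      β = B (e zero) (e zero)
      ω = coefficientOf (e zero) i
      τ = op (transpose (e zero) i)
      w = weight (e ∘ suc) η
      ρ = op (flip q)
      π = factors (e ∘ suc) η

      ω-central : Central ω
      ω-central = coefficientOf-central (e zero) i

      w-central : Central w
      w-central = ∏-central (filter (λ j → e (suc j) <? lookup η j) (allFin (suc k))) (λ j → γ-central (e (suc j)))

      τρ : τ * ρ ≈ op (flip σ)
      τρ = trans (op-· (transpose (e zero) i) (flip q))
        (op-cong _ (flip σ) (λ t → ≡.cong (q ⟨$⟩ʳ_) (transpose-comm i (e zero) t)))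

      βσ : β * op (flip σ) ≈ op (flip σ) * B x (e zero)
      -- σ⁻¹ takes x to i by q⁻¹ and then to `e zero` by the transposition.
      βσ = trans (*-congʳ (reflexive (≡.cong (λ t → B t (e zero)) (≡.sym (transpose-matchˡ i (e zero))))))
        (B-op (flip σ) x (e zero))

    guarded : ∀ {k} → (Fin k → Fin n) → Vec (Fin n) k → Carrier
    guarded e η = if does (admissible? e η) then term e η else 0#

    -- An inadmissible tail gives no control over q, but then both sides are 0. Otherwise i and x =
    -- q(i) compare with `e zero` in the same way, which matches the guards as well as the
    -- coefficients.
    guarded-∷ : ∀ {k} (e : Fin (suc (suc k)) → Fin n) → Increasing e → ∀ η x →
                B (e zero) (e zero) * summand (e zero) (straighten (e ∘ suc) η ⟨$⟩ˡ x) * guarded (e ∘ suc) η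
                  ≈ guarded e (x ∷ η)
    guarded-∷ e inc η x = cases (admissible? (e ∘ suc) η) (e zero ≤? x)
      where
      q : Permutation′ n
      q = straighten (e ∘ suc) η

      i : Fin n
      i = q ⟨$⟩ˡ x

      β : Carrier
      β = B (e zero) (e zero)

      cases : Dec (∀ j → e (suc j) ≤ lookup η j) → Dec (e zero ≤ x) →
              β * summand (e zero) i * guarded (e ∘ suc) η ≈ guarded e (x ∷ η)
      cases (no ¬adm) _ = begin
        β * summand (e zero) i * guarded (e ∘ suc) η
          ≡⟨ ≡.cong (β * summand (e zero) i *_) (if-no (admissible? (e ∘ suc) η) ¬adm) ⟩
        β * summand (e zero) i * 0#
          ≈⟨ zeroʳ _ ⟩
        0#
          ≡⟨ if-no (admissible? e (x ∷ η)) (λ adm → ¬adm (adm ∘ suc)) ⟨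
        guarded e (x ∷ η)
          ∎
      cases (yes adm) e≤?x = compare e≤?x
        where
        -- The case t = `e zero` matters: the coefficient depends on a strict comparison, and the
        -- complement of the indices above `e zero` contains `e zero`.
        fixes : ∀ t → t ≤ e zero → q ⟨$⟩ʳ t ≡ t
        fixes t t≤e = straighten-fixes (e ∘ suc) η (λ i<j → inc (s≤s i<j)) adm t (ℕ.≤-<-trans t≤e (inc (s≤s z≤n)))

        e≤i⇔e≤x : e zero ≤ i ⇔ e zero ≤ x
        e≤i⇔e≤x = fixes-complement⇒stable (e zero ≤?_) q (λ t e≰t → fixes t (ℕ.≰⇒≥ e≰t)) x

        e<i⇔e<x : e zero < i ⇔ e zero < x
        e<i⇔e<x = fixes-complement⇒stable (e zero <?_) q (λ t e≮t → fixes t (ℕ.≮⇒≥ e≮t)) x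

        compare : Dec (e zero ≤ x) → β * summand (e zero) i * guarded (e ∘ suc) η ≈ guarded e (x ∷ η)
        compare (no e≰x) = begin
          β * summand (e zero) i * guarded (e ∘ suc) η
            ≡⟨ ≡.cong (λ y → β * y * _) (if-no (e zero ≤? i) (e≰x ∘ Equivalence.to e≤i⇔e≤x)) ⟩
          β * 0# * guarded (e ∘ suc) η
            ≈⟨ trans (*-congʳ (zeroʳ β)) (zeroˡ _) ⟩
          0#
            ≡⟨ if-no (admissible? e (x ∷ η)) (λ adm′ → e≰x (adm′ zero)) ⟨
          guarded e (x ∷ η)
            ∎
        compare (yes e≤x) = begin
          β * summand (e zero) i * guarded (e ∘ suc) η
            ≡⟨ ≡.cong₂ (λ y z → β * y * z) (if-yes (e zero ≤? i) (Equivalence.from e≤i⇔e≤x e≤x))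
                 (if-yes (admissible? (e ∘ suc) η) adm) ⟩
          β * (coefficientOf (e zero) i * op (transpose (e zero) i)) * term (e ∘ suc) η
            ≈⟨ term-∷ e x η (≡.cong (λ b → if b then γ (e zero) else 1#) (does-⇔ e<i⇔e<x (_ <? i) (_ <? x))) ⟩
          term e (x ∷ η)
            ≡⟨ if-yes (admissible? e (x ∷ η)) (λ { zero → e≤x ; (suc j) → adm j }) ⟨
          guarded e (x ∷ η)
            ∎

    op-flip-id : op (flip id) ≈ 1#
    op-flip-id = trans (op-cong (flip id) id (λ _ → ≡.refl)) op-id

    -- General in `e` because the tail of a bracket is the bracket of `e ∘ suc`. Monotonicity
    -- provides the fixed points of q; the condition on the maximum settles the last factor.
    bracket-∑ : ∀ {k} (e : Fin k → Fin n) → Increasing e → PreservesMaximum e →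
                bracket e ≈ ∑ rawRing (filter (admissible? e) (tuples n k)) (term e)
    bracket-∑ {zero} e inc max = sym (begin
      1# * (op (flip id) * 1#) + 0#  ≈⟨ trans (+-identityʳ _) (*-identityˡ _) ⟩
      op (flip id) * 1#              ≈⟨ trans (*-identityʳ _) op-flip-id ⟩
      1#                             ∎)
    bracket-∑ {suc zero} e inc max = sym (begin
      ∑ rawRing (filter (admissible? e) (tuples n 1)) (term e)
        ≈⟨ ∑-filter (admissible? e) (tuples n 1) (term e) ⟩
      ∑ rawRing (tuples n 1) (guarded e)
        ≈⟨ ∑-cartesianProductWith _∷_ (allFin n) ([] ∷ []) (guarded e) ⟩
      ∑ rawRing (allFin n) (λ x → guarded e (x ∷ []) + 0#)
        ≈⟨ ∑-cong (allFin n) (λ _ → +-identityʳ _) ⟩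
      ∑ rawRing (allFin n) (λ x → guarded e (x ∷ []))
        -- No Π follows the last factor. Correspondingly, admissibility bounds x below by `e zero`
        -- and maximality bounds it above, leaving one term with weight 1 and the identity
        -- permutation.
        ≈⟨ ∑-single (allFin⁺ n) (∈-allFin (e zero)) off ⟩
      guarded e (e zero ∷ [])
        ≈⟨ on ⟩
      B (e zero) (e zero)
        ∎)
      where
      off : ∀ x → x ≢ e zero → guarded e (x ∷ []) ≈ 0#
      off x x≢e = reflexive (if-no (admissible? e (x ∷ []))
        (λ adm → x≢e (≤-antisym (max zero (λ { zero → z≤n }) x) (adm zero))))

      on : guarded e (e zero ∷ []) ≈ B (e zero) (e zero)
      on = begin
        guarded e (e zero ∷ [])
          ≡⟨ if-yes (admissible? e (e zero ∷ [])) (λ { zero → ℕ.≤-refl }) ⟩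
        weight e (e zero ∷ []) * (op (flip id) * (B (e zero) (e zero) * 1#))
          ≈⟨ *-cong (∏-filter (λ j → e j <? lookup (e zero ∷ []) j) (allFin 1) (γ ∘ e))
               (*-cong op-flip-id (*-identityʳ _)) ⟩
        (if does (e zero <? e zero) then γ (e zero) else 1#) * 1# * (1# * B (e zero) (e zero))
          ≈⟨ *-cong (trans (*-identityʳ _) (reflexive (if-no (e zero <? e zero) (<-irrefl ≡.refl)))) (*-identityˡ _) ⟩
        1# * B (e zero) (e zero)
          ≈⟨ *-identityˡ _ ⟩
        B (e zero) (e zero)
          ∎
    bracket-∑ {suc (suc k)} e inc max = begin
      β * Π (e zero) * bracket (e ∘ suc)
        ≈⟨ *-cong (*-congˡ (Π-∑ (e zero)))
             (trans (bracket-∑ (e ∘ suc) (λ i<j → inc (s≤s i<j)) max-suc) (∑-filter (admissible? (e ∘ suc)) ηs _)) ⟩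
      β * ∑ rawRing (allFin n) (summand (e zero)) * ∑ rawRing ηs (guarded (e ∘ suc))
        ≈⟨ *-congʳ (∑-*ˡ (allFin n) β _) ⟩
      ∑ rawRing (allFin n) (λ i → β * summand (e zero) i) * ∑ rawRing ηs (guarded (e ∘ suc))
        ≈⟨ ∑-*ˡ ηs _ _ ⟩
      ∑ rawRing ηs (λ η → ∑ rawRing (allFin n) (λ i → β * summand (e zero) i) * guarded (e ∘ suc) η)
        -- The substitution depends on η, so it is made while the sum over tails is outermost; the
        -- exchange after it restores the order of `tuples`.
        ≈⟨ ∑-cong ηs reindex ⟩
      ∑ rawRing ηs (λ η → ∑ rawRing (allFin n) (λ x → guarded e (x ∷ η)))
        ≈⟨ ∑-swap ηs (allFin n) (λ η x → guarded e (x ∷ η)) ⟩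
      ∑ rawRing (allFin n) (λ x → ∑ rawRing ηs (λ η → guarded e (x ∷ η)))
        ≈⟨ ∑-cartesianProductWith _∷_ (allFin n) ηs (guarded e) ⟨
      ∑ rawRing (tuples n (suc (suc k))) (guarded e)
        ≈⟨ ∑-filter (admissible? e) (tuples n (suc (suc k))) (term e) ⟨
      ∑ rawRing (filter (admissible? e) (tuples n (suc (suc k)))) (term e)
        ∎
      where
      β : Carrier
      β = B (e zero) (e zero)

      ηs : List (Vec (Fin n) (suc k))
      ηs = tuples n (suc k)

      max-suc : PreservesMaximum (e ∘ suc)
      max-suc j j-max = max (suc j) (λ { zero → z≤n ; (suc i) → s≤s (j-max i) })

      reindex : ∀ η → ∑ rawRing (allFin n) (λ i → β * summand (e zero) i) * guarded (e ∘ suc) η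
                        ≈ ∑ rawRing (allFin n) (λ x → guarded e (x ∷ η))
      reindex η = begin
        ∑ rawRing (allFin n) (λ i → β * summand (e zero) i) * guarded (e ∘ suc) η
          ≈⟨ ∑-*ʳ (allFin n) _ _ ⟩
        ∑ rawRing (allFin n) (λ i → β * summand (e zero) i * guarded (e ∘ suc) η)
          -- q = straighten (e ∘ suc) η fixes everything up to e zero, so i ↦ x = q(i) permutes {i | e zero ≤ i}.
          ≈⟨ ∑-permute (flip (straighten (e ∘ suc) η)) _ ⟩
        ∑ rawRing (allFin n) (λ x → β * summand (e zero) (straighten (e ∘ suc) η ⟨$⟩ˡ x) * guarded (e ∘ suc) η)
          ≈⟨ ∑-cong (allFin n) (guarded-∷ e inc η) ⟩
        ∑ rawRing (allFin n) (λ x → guarded e (x ∷ η))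
          ∎

-- The expansion over the reflection algebra

module _ {c ℓ₁ ℓ₂} (K : HeytingField c ℓ₁ ℓ₂) (char0 : CharacteristicZero K) (m l : ℕ) where
  open Bracket K char0 m l
  open import Data.Integer.Base using (+_; -[1+_])
  private
    module K = CommutativeRing commutativeRing
    module KP = RingProperties K.ring
    module Alg = Ring reflectionAlgebra
    module AlgP = RingProperties reflectionAlgebra
    module SP = PowerSeries reflectionAlgebra
    S = SP.powerSeries
    module S = Ring S
    module T = TensorEnd S n n
    module E = Ring T.matrices
    module X = Expanding T.matrices n
    module KS = RawRing K[[u⁻¹]]

  fromℤ-neg : ∀ z → fromℤ (ℤ.- z) K.≈ K.- fromℤ z
  fromℤ-neg (+ zero)  = K.sym KP.-0#≈0#
  fromℤ-neg (+ suc k) = K.refl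
  fromℤ-neg -[1+ k ]  = K.sym (KP.-‿involutive _)

  [u-]⁻¹-cong : ∀ {y z} → y K.≈ z → ∀ s → [u-_]⁻¹ K.rawRing y s K.≈ [u-_]⁻¹ K.rawRing z s
  [u-]⁻¹-cong y≈z zero    = K.refl
  [u-]⁻¹-cong y≈z (suc k) = Exp.^-congˡ K.semiring k y≈z

  -- Changing both signs keeps the root -z/2 and negates the leading factor, as `1/ -[1+ 1 ]` is by
  -- definition the negative of `1/ (+ 2)`.
  1/-neg : ∀ z s → 1/[ -[1+ 1 ] u+ ℤ.- z ] s K.≈ K.- 1/[ + 2 u+ z ] s
  1/-neg z s = K.trans (K.*-congˡ ([u-]⁻¹-cong root s)) (K.sym (KP.-‿distribˡ-* _ _))
    where
    root : K.- (fromℤ (ℤ.- z) K.* (K.- 1/ (+ 2))) K.≈ K.- (fromℤ z K.* 1/ (+ 2))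
    root = K.-‿cong (begin
      fromℤ (ℤ.- z) K.* (K.- 1/ (+ 2))     ≈⟨ K.*-congʳ (fromℤ-neg z) ⟩
      (K.- fromℤ z) K.* (K.- 1/ (+ 2))     ≈⟨ KP.-‿distribˡ-* _ _ ⟨
      K.- (fromℤ z K.* (K.- 1/ (+ 2)))     ≈⟨ K.-‿cong (KP.-‿distribʳ-* _ _) ⟨
      K.- (K.- (fromℤ z K.* 1/ (+ 2)))     ≈⟨ KP.-‿involutive _ ⟩
      fromℤ z K.* 1/ (+ 2)                 ∎)
      where open import Relation.Binary.Reasoning.Setoid K.setoid

  scalar-∑ : ∀ {X : Set} (xs : List X) f → scalar (∑ K.rawRing xs f) Alg.≈ ∑ 𝓑 xs (λ x → scalar (f x))
  scalar-∑ []       f = Alg.refl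
  scalar-∑ (x ∷ xs) f = Alg.trans (scalar-+ _ _) (Alg.+-congˡ (scalar-∑ xs f))

  scalar-neg : ∀ y → scalar (K.- y) Alg.≈ Alg.- scalar y
  scalar-neg y = AlgP.+-inverseˡ-unique _ _
    (Alg.trans (Alg.sym (scalar-+ _ _)) (scalar-cong (K.-‿inverseˡ y)))

  embed : (ℕ → K.Carrier) → ℕ → Alg.Carrier
  embed f s = scalar (f s)

  embed-* : ∀ f g → embed (f KS.* g) S.≈ embed f S.* embed g
  embed-* f g s = Alg.trans (scalar-∑ (upTo (suc s)) _)
    (Sums.∑-cong reflectionAlgebra (upTo (suc s)) (λ i → scalar-* _ _))

  embed-1 : embed KS.1# S.≈ S.1#
  embed-1 zero    = Alg.refl
  embed-1 (suc _) = Alg.refl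

  embed-central : ∀ f g → embed f S.* g S.≈ g S.* embed f
  embed-central f = SP.⊛-comm (embed f) (λ i → scalar-comm (f i))

  -- The structure map of `End` as an algebra over K[[u⁻¹]]: its values are central, and `_•_` is
  -- multiplication by them.
  φ : (ℕ → K.Carrier) → Carrier
  φ f = f • 1#

  •-φ : ∀ f M → f • M ≈ φ f * M
  •-φ f = T.scale-⊡ (embed f)

  φ-central : ∀ f M → φ f * M ≈ M * φ f
  φ-central f = T.scale-central (embed-central f)

  φ-* : ∀ f g → φ (f KS.* g) ≈ φ f * φ g
  φ-* f g = E.trans {φ (f KS.* g)} {f • φ g} {φ f * φ g}
    (λ I J → S.trans (S.*-congʳ (embed-* f g)) (S.*-assoc (embed f) (embed g) (1# I J)))
    (•-φ f (φ g))

  φ-1 : φ KS.1# ≈ 1#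
  φ-1 I J = S.trans (S.*-congʳ embed-1) (S.*-identityˡ (1# I J))

  φ-∏ : ∀ {X : Set} (xs : List X) f → φ (∏ K[[u⁻¹]] xs f) ≈ ∏ End xs (φ ∘ f)
  φ-∏ []       f = φ-1
  φ-∏ (x ∷ xs) f = E.trans (φ-* (f x) (∏ K[[u⁻¹]] xs f)) (E.*-congˡ (φ-∏ xs f))

  series : Fin n → ℕ → K.Carrier
  series k = 1/[ -[1+ 1 ] u+ + n ℤ.- + 2 ℤ.+ number k ]

  γ : Fin n → Carrier
  γ = φ ∘ series

  γ-central : ∀ k M → γ k * M ≈ M * γ k
  γ-central = φ-central ∘ series

  B-operator : ∀ σ t k → B (σ ⟨$⟩ʳ t) k * operator σ ≈ operator σ * B t k
  B-operator σ t k = T.at-operator (λ i j → shift 𝓑 (toℕ k) (generatingMatrix i j)) σ t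

  open X.Interlacing operator B γ γ-central T.operator-cong T.operator-id T.operator-· B-operator
    renaming (Π to Π′)

  Π≈Π′ : ∀ k → Π k ≈ Π′ k
  Π≈Π′ k = E.+-congˡ {1#} (E.trans { - (f • ∑P)} {g • ∑P} {φ g * ∑P} neg (•-φ g ∑P))
    where
    z : ℤ
    z = ℤ.- number k ℤ.- + n ℤ.+ + 2

    f g : ℕ → K.Carrier
    f = 1/[ + 2 u+ z ]
    g = series k

    ∑P : Carrier
    ∑P = ∑ End (filter (k <?_) (allFin n)) (λ i → operator (transpose k i))

    opposite : ∀ a b → b ℤ.- + 2 ℤ.+ a ≡ ℤ.- (ℤ.- a ℤ.- b ℤ.+ + 2)
    opposite = solve-∀

    g≈-f : ∀ s → g s K.≈ K.- f s
    g≈-f s = K.trans (K.reflexive (≡.cong (λ w → 1/[ -[1+ 1 ] u+ w ] s) (opposite (number k) (+ n)))) (1/-neg z s)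

    neg : - (f • ∑P) ≈ g • ∑P
    neg I J = S.trans (RingProperties.-‿distribˡ-* S (embed f) (∑P I J))
      (S.*-congʳ (λ s → Alg.trans (Alg.sym (scalar-neg (f s))) (scalar-cong (K.sym (g≈-f s)))))

  -- `allFin n` tabulates the identity, and the tail of a tabulated list is tabulated by `e ∘ suc`.
  interlace-bracket : ∀ {k} (e : Fin k → Fin n) → interlace (List.tabulate e) ≈ bracket e
  interlace-bracket {zero}        e = E.refl
  interlace-bracket {suc zero}    e = E.refl
  interlace-bracket {suc (suc k)} e =
    E.*-cong (E.*-congˡ (Π≈Π′ (e zero))) (interlace-bracket (e ∘ suc))

  -- The weight is a product formed in `End`, while α is formed among scalar series;
  -- multiplicativity of `φ` identifies them.
  term-α : ∀ η → term (λ i → i) η ≈ α η • (operator (flip (p η)) * ∏ End (allFin n) (λ i → B (lookup η i) i))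
  term-α η = begin
    weight (λ i → i) η * (operator (flip (straighten (λ i → i) η)) * ∏B)
      ≡⟨ ≡.cong (λ σ → weight (λ i → i) η * (operator (flip σ) * ∏B)) (p-straighten η) ⟨
    weight (λ i → i) η * (operator (flip (p η)) * ∏B)
      ≈⟨ E.*-congʳ (φ-∏ (filter (λ i → i <? lookup η i) (allFin n)) _) ⟨
    φ (α η) * (operator (flip (p η)) * ∏B)
      ≈⟨ •-φ (α η) _ ⟨
    α η • (operator (flip (p η)) * ∏B)
      ∎
    where
    open import Relation.Binary.Reasoning.Setoid E.setoid

    ∏B : Carrier
    ∏B = ∏ End (allFin n) (λ i → B (lookup η i) i)

  interlace-∑ : ⟪B₁,…,Bₙ⟫ ≈ ∑ End (I n) (λ η → α η • (operator (flip (p η)) * ∏ End (allFin n) (λ i → B (lookup η i) i)))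
  interlace-∑ = begin
    ⟪B₁,…,Bₙ⟫                          ≈⟨ interlace-bracket (λ i → i) ⟩
    bracket (λ i → i)                  ≈⟨ bracket-∑ (λ i → i) (λ i<j → i<j) (λ j j-max → j-max) ⟩
    ∑ End (I n) (term (λ i → i))       ≈⟨ Sums.∑-cong T.matrices (I n) term-α ⟩
    ∑ End (I n) (λ η → α η • (operator (flip (p η)) * ∏ End (allFin n) (λ i → B (lookup η i) i))) ∎
    where open import Relation.Binary.Reasoning.Setoid E.setoid

proposition4 : ∀ {c ℓ₁ ℓ₂} (K : HeytingField c ℓ₁ ℓ₂) (char0 : CharacteristicZero K) (m l : ℕ) →
    let open Bracket K char0 m l in
    ⟪B₁,…,Bₙ⟫ ≈ ∑ End (I n) (λ η → α η • (operator (flip (p η)) * ∏ End (allFin n) (λ i → B (lookup η i) i)))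
proposition4 = interlace-∑
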